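{- Let the sequence $(b_0,b_1,\ldots)$ be defined by $b_0:=0$ and $b_k:=E_{2k-1}(1)$ for $k\ge1$, where $E_j(x)$ are the Euler polynomials. Then for all $n\ge1$, $$H_n(b_k)=(-1)^n\frac{2^{2n+1}}{(2n+1)!}\cdot\mathcal{H}_n\cdot H_n\big(E_{2k+1}(1)\big),\qquad\text{where}\quad \mathcal{H}_n:=\sum_{j=1}^n\frac1j.$$
   Context: For a sequence $(a_k)_{k\ge 0}$ and $n\ge 0$, $H_n(a_k):=\det(a_{i+j})_{0\le i,j\le n}$ denotes the $(n+1)\times(n+1)$ Hankel determinant; thus $H_n(E_{2k+1}(1))$ is the Hankel determinant of the sequence $(E_{2k+1}(1))_{k\ge0}$. The Euler polynomials are defined by $\frac{2e^{xt}}{e^t+1}=\sum_{n\ge0}E_n(x)\frac{t^n}{n!}$. -}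

module Defs where

open import Algebra.Bundles using (CommutativeRing)
open import Data.Fin.Base as Fin using (Fin; toℕ; punchIn)
open import Data.Integer.Base using (+_)
open import Data.Nat.Base as ℕ using (ℕ; zero; suc; _!)
open import Data.Nat.Properties using (_!≢0)
open import Data.Rational.Base
open import Data.Rational.Properties
open import Relation.Binary.PropositionalEquality

open import Algebra.Properties.Semiring.Sum (CommutativeRing.semiring +-*-commutativeRing) public
  using (sum)
open import Algebra.Properties.Semiring.Exp (CommutativeRing.semiring +-*-commutativeRing) public
  using (_^_)

-- A formal power series over ℚ: f stands for Σ_k f(k) tᵏ.
Series : Set
Series = ℕ → ℚ

one : Series
one zero    = 1ℚ
one (suc _) = 0ℚ

infixl 6 _⊕_
_⊕_ : Series → Series → Series
(f ⊕ g) k = f k + g k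

infixl 7 _⊛_
_⊛_ : Series → Series → Series
(f ⊛ g) n = sum {suc n} (λ k → f (toℕ k) * g (n ℕ.∸ toℕ k))

-- Long division.  If q₀ = f₀ / g₀, then f = q₀ g + t r, where
-- r_k = f_{k+1} − q₀ g_{k+1}, hence f / g = q₀ + t (r / g).
quotient : (f g : Series) .{{_ : NonZero (g 0)}} → Series
quotient f g zero    = f 0 ÷ g 0
quotient f g (suc n) = quotient (λ k → f (suc k) - (f 0 ÷ g 0) * g (suc k)) g n

quotient-⊛ : ∀ f g .{{_ : NonZero (g 0)}} n → (quotient f g ⊛ g) n ≡ f n
quotient-⊛ f g zero = begin
  f 0 * 1/ g 0 * g 0 + 0ℚ  ≡⟨ +-identityʳ _ ⟩
  f 0 * 1/ g 0 * g 0       ≡⟨ *-assoc (f 0) (1/ g 0) (g 0) ⟩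
  f 0 * (1/ g 0 * g 0)     ≡⟨ cong (f 0 *_) (*-inverseˡ (g 0)) ⟩
  f 0 * 1ℚ                 ≡⟨ *-identityʳ (f 0) ⟩
  f 0                      ∎
  where open ≡-Reasoning
quotient-⊛ f g (suc n) = begin
  a + (quotient r g ⊛ g) n  ≡⟨ cong (λ z → a + z) (quotient-⊛ r g n) ⟩
  a + (f (suc n) - a)       ≡⟨ +-comm a _ ⟩
  f (suc n) - a + a         ≡⟨ +-assoc (f (suc n)) (- a) a ⟩
  f (suc n) + (- a + a)     ≡⟨ cong (λ z → f (suc n) + z) (+-inverseˡ a) ⟩
  f (suc n) + 0ℚ            ≡⟨ +-identityʳ _ ⟩
  f (suc n)                 ∎
  where
  open ≡-Reasoning
  a : ℚ
  a = (f 0 ÷ g 0) * g (suc n)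
  r : Series
  r k = f (suc k) - (f 0 ÷ g 0) * g (suc k)

-- exp x is the series of e^{xt}.
exp : ℚ → Series
exp x k = x ^ k * (_/_ (+ 1) (k !) {{k !≢0}})

e^t+1 : Series
e^t+1 = exp 1ℚ ⊕ one

2e^xt : ℚ → Series
2e^xt x = exp x ⊕ exp x

-- The n-th Euler polynomial, as a function of x ∈ ℚ:
-- E n x / n! is the coefficient of tⁿ in 2e^{xt} / (eᵗ + 1).
E : ℕ → ℚ → ℚ
E n x = (+ (n !)) / 1 * quotient (2e^xt x) e^t+1 n

Matrix : ℕ → Set
Matrix n = Fin n → Fin n → ℚ

-- Laplace expansion along the first row.
det : ∀ {n} → Matrix n → ℚ
det {zero}  A = 1ℚ
det {suc n} A = sum (λ k →
  (- 1ℚ) ^ toℕ k * A Fin.zero k * det (λ i j → A (Fin.suc i) (punchIn k j)))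

-- H n has size n + 1, with indices running from 0 to n.
H : ℕ → (ℕ → ℚ) → ℚ
H n a = det {suc n} (λ i j → a (toℕ i ℕ.+ toℕ j))

harmonic : ℕ → ℚ
harmonic n = sum {n} (λ j → (+ 1) / suc (toℕ j))

b : ℕ → ℚ
b zero      = 0ℚ
b k@(suc _) = E (2 ℕ.* k ℕ.∸ 1) 1ℚ

{-# OPTIONS --safe #-}
-- The series u = 2eᵗ/(eᵗ + 1) - 1 = tanh (t/2) satisfies u′ = (1 - u²)/2, so (d/dt)² acts
-- tridiagonally on the odd powers of u.  Hence there are polynomials pₙ of degree n with
-- pₙ((d/dt)²) u = u²ⁿ⁺¹, and since u²ⁿ⁺¹ = O(t²ⁿ⁺¹) they are orthogonal for the moments
-- E₂ₖ₊₁(1), the (2k+1)-st derivatives of u at 0.  The numbers b are the even derivatives at 0 of the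
-- antiderivative W of u with W(0) = 0, and pₙ((d/dt)²) W is the antiderivative of u²ⁿ⁺¹ with
-- constant term ℋₙ, because ∫ (u²ⁿ⁻¹ - u²ⁿ⁺¹) = u²ⁿ/n.  Replacing the last column of either
-- Hankel matrix by the combination with the coefficients of pₙ therefore leaves a single
-- nonzero entry in it: the first, ℋₙ, for b and the last, (2n+1)!/2²ⁿ⁺¹, for E₂ₖ₊₁(1).  The
-- complementary minor is the same in both cases.
module Submission where

open import Algebra.Bundles using (CommutativeRing)
open import Data.Fin.Base as Fin using (Fin; toℕ; punchIn; punchOut; inject₁; fromℕ)
open import Data.Fin.Properties as Fin using (punchIn-injective; punchIn-punchOut; punchInᵢ≢i)
open import Data.Integer.Base as ℤ using (+_)
import Data.Integer.Properties as ℤ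
open import Data.Nat.Base as ℕ using (ℕ; zero; suc; _!; z≤n; s≤s)
import Data.Nat.Properties as ℕ
open import Data.Nat.Properties using (_!≢0)
open import Data.Product.Base using (∃; _,_; _×_)
open import Data.Rational.Base
open import Data.Rational.Properties
import Data.Rational.Unnormalised.Base as ℚᵘ
import Data.Rational.Unnormalised.Properties as ℚᵘ
open import Data.Vec.Functional using (updateAt)
open import Data.Vec.Functional.Properties using (updateAt-updates; updateAt-minimal)
open import Function.Base using (_∘_; const)
open import Level using (0ℓ)
open import Relation.Binary.Definitions using (tri<; tri≈; tri>)
open import Relation.Binary.PropositionalEquality
open import Relation.Nullary.Decidable using (yes; no; dec⇒maybe)
open import Relation.Nullary.Negation using (contradiction)
open import Tactic.RingSolver using (solve-∀)
open import Tactic.RingSolver.Core.AlmostCommutativeRing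
  using (AlmostCommutativeRing; fromCommutativeRing)
open import Algebra.Properties.Semiring.Sum (CommutativeRing.semiring +-*-commutativeRing)
  using (sum-cong-≗; sum-init-last; sum-remove; ∑-distrib-+; *-distribˡ-sum; sum-replicate-zero)
open import Defs

open ≡-Reasoning

ℚ-ring : AlmostCommutativeRing 0ℓ 0ℓ
ℚ-ring = fromCommutativeRing +-*-commutativeRing (λ x → dec⇒maybe (0ℚ ≟ x))

-- Determinants

sum-zero : ∀ {n} {f : Fin n → ℚ} → (∀ k → f k ≡ 0ℚ) → sum f ≡ 0ℚ
sum-zero {n} f≡0 = trans (sum-cong-≗ f≡0) (sum-replicate-zero n)

sum-single : ∀ {n} (f : Fin n → ℚ) j → (∀ k → k ≢ j → f k ≡ 0ℚ) → sum f ≡ f j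
sum-single {suc n} f j f≡0 = begin
  sum f                       ≡⟨ sum-remove {i = j} f ⟩
  f j + sum (f ∘ punchIn j)   ≡⟨ cong (λ z → f j + z) (sum-zero λ k → f≡0 (punchIn j k) (punchInᵢ≢i j k)) ⟩
  f j + 0ℚ                    ≡⟨ +-identityʳ (f j) ⟩
  f j                         ∎

sum-linear : ∀ {n} x y (f g : Fin n → ℚ) →
  sum (λ k → x * f k + y * g k) ≡ x * sum f + y * sum g
sum-linear x y f g = trans (∑-distrib-+ (λ k → x * f k) (λ k → y * g k))
  (cong₂ _+_ (sym (*-distribˡ-sum x f)) (sym (*-distribˡ-sum y g)))

-- For Laplace expansions of a matrix with two equal adjacent columns, where only the terms deleting
-- one of these two columns survive.
sum-adjacent : ∀ {n} (f : Fin (suc n) → ℚ) (j : Fin n) →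
  (∀ k → k ≢ inject₁ j → k ≢ Fin.suc j → f k ≡ 0ℚ) →
  sum f ≡ f (inject₁ j) + f (Fin.suc j)
sum-adjacent f Fin.zero f≡0 = begin
  f Fin.zero + (f (Fin.suc Fin.zero) + sum (λ k → f (Fin.suc (Fin.suc k))))
    ≡⟨ cong (λ z → f Fin.zero + (f (Fin.suc Fin.zero) + z))
         (sum-zero λ k → f≡0 (Fin.suc (Fin.suc k)) (λ ()) (λ ())) ⟩
  f Fin.zero + (f (Fin.suc Fin.zero) + 0ℚ)
    ≡⟨ cong (λ z → f Fin.zero + z) (+-identityʳ _) ⟩
  f Fin.zero + f (Fin.suc Fin.zero) ∎
sum-adjacent f (Fin.suc j) f≡0 = begin
  f Fin.zero + sum (f ∘ Fin.suc)
    ≡⟨ cong₂ _+_ (f≡0 Fin.zero (λ ()) (λ ()))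
         (sum-adjacent (f ∘ Fin.suc) j λ k p q →
            f≡0 (Fin.suc k) (p ∘ Fin.suc-injective) (q ∘ Fin.suc-injective)) ⟩
  0ℚ + (f (inject₁ (Fin.suc j)) + f (Fin.suc (Fin.suc j)))
    ≡⟨ +-identityˡ _ ⟩
  f (inject₁ (Fin.suc j)) + f (Fin.suc (Fin.suc j)) ∎

minor : ∀ {n} → Matrix (suc n) → Fin (suc n) → Matrix n
minor A k i j = A (Fin.suc i) (punchIn k j)

laplaceTerm : ∀ {n} → Matrix (suc n) → Fin (suc n) → ℚ
laplaceTerm A k = (- 1ℚ) ^ toℕ k * A Fin.zero k * det (minor A k)

det-cong : ∀ {n} {A B : Matrix n} → (∀ i j → A i j ≡ B i j) → det A ≡ det B
det-cong {zero}  A≡B = refl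
det-cong {suc n} A≡B = sum-cong-≗ λ k →
  cong₂ _*_ (cong (λ z → (- 1ℚ) ^ toℕ k * z) (A≡B Fin.zero k))
            (det-cong λ i j → A≡B (Fin.suc i) (punchIn k j))

punchIn-≢ : ∀ {n} {k j : Fin (suc n)} (k≢j : k ≢ j) {l} → l ≢ punchOut k≢j → punchIn k l ≢ j
punchIn-≢ {k = k} k≢j l≢ eq =
  l≢ (punchIn-injective k _ _ (trans eq (sym (punchIn-punchOut k≢j))))

-- In the Laplace term at `j` the entry carries the linear combination and the minors agree; in
-- every other term the minor carries it, in column `punchOut k≢j`. Relating three matrices that
-- agree off column `j` lets the induction pass to minors directly.
det-linear : ∀ {n} (j : Fin n) x y {A B C : Matrix n} →
  (∀ i k → k ≢ j → C i k ≡ A i k) →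
  (∀ i k → k ≢ j → C i k ≡ B i k) →
  (∀ i → C i j ≡ x * A i j + y * B i j) →
  det C ≡ x * det A + y * det B
det-linear {suc n} j x y {A} {B} {C} C≡A C≡B Cj =
  trans (sum-cong-≗ term) (sum-linear x y (laplaceTerm A) (laplaceTerm B))
  where
  entry : ∀ s x y a b d → s * (x * a + y * b) * d ≡ x * (s * a * d) + y * (s * b * d)
  entry = solve-∀ ℚ-ring
  cofactor : ∀ s x y a d e → s * a * (x * d + y * e) ≡ x * (s * a * d) + y * (s * a * e)
  cofactor = solve-∀ ℚ-ring
  term : ∀ k → laplaceTerm C k ≡ x * laplaceTerm A k + y * laplaceTerm B k
  term k with k Fin.≟ j
  ... | yes refl = begin
    s * C Fin.zero k * det (minor C k)
      ≡⟨ cong (λ z → s * z * det (minor C k)) (Cj Fin.zero) ⟩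
    s * (x * A Fin.zero k + y * B Fin.zero k) * det (minor C k)
      ≡⟨ entry s x y _ _ _ ⟩
    x * (s * A Fin.zero k * det (minor C k)) + y * (s * B Fin.zero k * det (minor C k))
      ≡⟨ cong₂ (λ d e → x * (s * A Fin.zero k * d) + y * (s * B Fin.zero k * e))
           (det-cong λ i l → C≡A (Fin.suc i) (punchIn k l) (punchInᵢ≢i k l))
           (det-cong λ i l → C≡B (Fin.suc i) (punchIn k l) (punchInᵢ≢i k l)) ⟩
    x * laplaceTerm A k + y * laplaceTerm B k ∎
    where
    s : ℚ
    s = (- 1ℚ) ^ toℕ k
  ... | no k≢j = begin
    s * C Fin.zero k * det (minor C k)
      ≡⟨ cong (λ z → s * C Fin.zero k * z) (det-linear (punchOut k≢j) x y
           (λ i l l≢ → C≡A (Fin.suc i) (punchIn k l) (punchIn-≢ k≢j l≢))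
           (λ i l l≢ → C≡B (Fin.suc i) (punchIn k l) (punchIn-≢ k≢j l≢))
           (λ i → subst (λ l → C (Fin.suc i) l ≡ x * A (Fin.suc i) l + y * B (Fin.suc i) l)
                        (sym (punchIn-punchOut k≢j)) (Cj (Fin.suc i)))) ⟩
    s * C Fin.zero k * (x * det (minor A k) + y * det (minor B k))
      ≡⟨ cofactor s x y _ _ _ ⟩
    x * (s * C Fin.zero k * det (minor A k)) + y * (s * C Fin.zero k * det (minor B k))
      ≡⟨ cong₂ (λ a b → x * (s * a * det (minor A k)) + y * (s * b * det (minor B k)))
           (C≡A Fin.zero k k≢j) (C≡B Fin.zero k k≢j) ⟩
    x * laplaceTerm A k + y * laplaceTerm B k ∎
    where
    s : ℚ
    s = (- 1ℚ) ^ toℕ k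

-- A zero column is the combination of itself with itself with both coefficients 0.
det-zeroColumn : ∀ {n} (j : Fin n) {A : Matrix n} → (∀ i → A i j ≡ 0ℚ) → det A ≡ 0ℚ
det-zeroColumn j {A} Aj≡0 = begin
  det A                        ≡⟨ det-linear j 0ℚ 0ℚ {A} {A} (λ _ _ _ → refl) (λ _ _ _ → refl)
                                    (λ i → trans (Aj≡0 i) (zeros (A i j))) ⟩
  0ℚ * det A + 0ℚ * det A      ≡⟨ zeros (det A) ⟨
  0ℚ                           ∎
  where
  zeros : ∀ z → 0ℚ ≡ 0ℚ * z + 0ℚ * z
  zeros = solve-∀ ℚ-ring

-- Makes the minors of the two surviving Laplace terms equal: deleting either of two equal
-- neighbours leaves the same row.
punchIn-adjacent : ∀ {n} (f : Fin (suc n) → ℚ) (j : Fin n) → f (inject₁ j) ≡ f (Fin.suc j) →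
  ∀ l → f (punchIn (inject₁ j) l) ≡ f (punchIn (Fin.suc j) l)
punchIn-adjacent f Fin.zero    eq Fin.zero    = sym eq
punchIn-adjacent f Fin.zero    eq (Fin.suc l) = refl
punchIn-adjacent f (Fin.suc j) eq Fin.zero    = refl
punchIn-adjacent f (Fin.suc j) eq (Fin.suc l) = punchIn-adjacent (f ∘ Fin.suc) j eq l

-- Deleting any other column leaves these two adjacent, at positions `l` and `l + 1` of the minor,
-- so that induction applies to the minor.
punchIn-adjacent⁻¹ : ∀ {n} (k : Fin (suc (suc n))) (j : Fin (suc n)) →
  k ≢ inject₁ j → k ≢ Fin.suc j →
  ∃ λ l → punchIn k (inject₁ l) ≡ inject₁ j × punchIn k (Fin.suc l) ≡ Fin.suc j
punchIn-adjacent⁻¹ Fin.zero                  Fin.zero    p q = contradiction refl p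
punchIn-adjacent⁻¹ Fin.zero                  (Fin.suc j) p q = j , refl , refl
punchIn-adjacent⁻¹ (Fin.suc Fin.zero)        Fin.zero    p q = contradiction refl q
punchIn-adjacent⁻¹ {suc n} (Fin.suc (Fin.suc k)) Fin.zero p q = Fin.zero , refl , refl
punchIn-adjacent⁻¹ {suc n} (Fin.suc k)       (Fin.suc j) p q
  with punchIn-adjacent⁻¹ k j (p ∘ cong Fin.suc) (q ∘ cong Fin.suc)
... | l , eq₁ , eq₂ = Fin.suc l , cong Fin.suc eq₁ , cong Fin.suc eq₂

-- Minors that keep both columns vanish by induction; the two remaining terms have equal entries and
-- minors but opposite signs.
det-adjacentEqual : ∀ {n} (j : Fin n) {A : Matrix (suc n)} →
  (∀ i → A i (inject₁ j) ≡ A i (Fin.suc j)) → det A ≡ 0ℚ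
det-adjacentEqual {suc n} j {A} eq = trans (sum-adjacent (laplaceTerm A) j others) cancelling
  where
  others : ∀ k → k ≢ inject₁ j → k ≢ Fin.suc j → laplaceTerm A k ≡ 0ℚ
  others k p q with punchIn-adjacent⁻¹ k j p q
  ... | l , eq₁ , eq₂ = trans
    (cong (λ z → (- 1ℚ) ^ toℕ k * A Fin.zero k * z)
      (det-adjacentEqual l {minor A k} λ i → trans (cong (A (Fin.suc i)) eq₁)
        (trans (eq (Fin.suc i)) (cong (A (Fin.suc i)) (sym eq₂)))))
    (*-zeroʳ ((- 1ℚ) ^ toℕ k * A Fin.zero k))
  signs : ∀ s a d → s * a * d + - 1ℚ * s * a * d ≡ 0ℚ
  signs = solve-∀ ℚ-ring
  cancelling : laplaceTerm A (inject₁ j) + laplaceTerm A (Fin.suc j) ≡ 0ℚ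
  cancelling = begin
    (- 1ℚ) ^ toℕ (inject₁ j) * A Fin.zero (inject₁ j) * det (minor A (inject₁ j))
      + laplaceTerm A (Fin.suc j)
      ≡⟨ cong (_+ laplaceTerm A (Fin.suc j))
           (cong₂ _*_ (cong₂ (λ m a → (- 1ℚ) ^ m * a) (Fin.toℕ-inject₁ j) (eq Fin.zero))
             (det-cong λ i l → punchIn-adjacent (A (Fin.suc i)) j (eq (Fin.suc i)) l)) ⟩
    (- 1ℚ) ^ toℕ j * A Fin.zero (Fin.suc j) * det (minor A (Fin.suc j))
      + laplaceTerm A (Fin.suc j)
      ≡⟨ signs ((- 1ℚ) ^ toℕ j) _ _ ⟩
    0ℚ ∎

-- Replacing a column, and matrices with equal columns

infixl 9 _[_≔_]
_[_≔_] : ∀ {n} → Matrix n → Fin n → (Fin n → ℚ) → Matrix n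
(A [ j ≔ x ]) i = updateAt (A i) j (const (x i))

module _ {n} (A : Matrix n) (j : Fin n) where

  column-updated : ∀ x i → (A [ j ≔ x ]) i j ≡ x i
  column-updated x i = updateAt-updates j (A i)

  column-other : ∀ x i k → k ≢ j → (A [ j ≔ x ]) i k ≡ A i k
  column-other x i k k≢j = updateAt-minimal k j (A i) k≢j

  det-column-linear : ∀ x y (f g : Fin n → ℚ) →
    det (A [ j ≔ (λ i → x * f i + y * g i) ]) ≡ x * det (A [ j ≔ f ]) + y * det (A [ j ≔ g ])
  det-column-linear x y f g = det-linear j x y
    (λ i k k≢j → trans (column-other h i k k≢j) (sym (column-other f i k k≢j)))
    (λ i k k≢j → trans (column-other h i k k≢j) (sym (column-other g i k k≢j)))
    (λ i → trans (column-updated h i)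
      (sym (cong₂ (λ a b → x * a + y * b) (column-updated f i) (column-updated g i))))
    where
    h : Fin n → ℚ
    h i = x * f i + y * g i

  det-column-+ : ∀ (f g : Fin n → ℚ) →
    det (A [ j ≔ (λ i → f i + g i) ]) ≡ det (A [ j ≔ f ]) + det (A [ j ≔ g ])
  det-column-+ f g = begin
    det (A [ j ≔ (λ i → f i + g i) ])
      ≡⟨ det-cong (λ i k → cong (λ z → updateAt (A i) j (const z) k) (ones (f i) (g i))) ⟩
    det (A [ j ≔ (λ i → 1ℚ * f i + 1ℚ * g i) ])
      ≡⟨ det-column-linear 1ℚ 1ℚ f g ⟩
    1ℚ * det (A [ j ≔ f ]) + 1ℚ * det (A [ j ≔ g ])
      ≡⟨ ones (det (A [ j ≔ f ])) (det (A [ j ≔ g ])) ⟨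
    det (A [ j ≔ f ]) + det (A [ j ≔ g ]) ∎
    where
    ones : ∀ a b → a + b ≡ 1ℚ * a + 1ℚ * b
    ones = solve-∀ ℚ-ring

  det-column-sum : ∀ {m} (p : Fin m → ℚ) (F : Fin m → Fin n → ℚ) →
    det (A [ j ≔ (λ i → sum (λ k → p k * F k i)) ]) ≡ sum (λ k → p k * det (A [ j ≔ F k ]))
  det-column-sum {zero}  p F = det-zeroColumn j (column-updated (λ _ → 0ℚ))
  det-column-sum {suc m} p F = begin
    det (A [ j ≔ (λ i → p₀ * F₀ i + R i) ])
      ≡⟨ det-column-+ (λ i → p₀ * F₀ i) R ⟩
    det (A [ j ≔ (λ i → p₀ * F₀ i) ]) + det (A [ j ≔ R ])
      ≡⟨ cong (_+ det (A [ j ≔ R ])) (trans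
           -- A scalar multiple is written as a linear combination whose second coefficient is 0.
           (det-cong λ i k → cong (λ z → updateAt (A i) j (const z) k) (pad (p₀ * F₀ i) (F₀ i)))
           (trans (det-column-linear p₀ 0ℚ F₀ F₀) (sym (pad (p₀ * det (A [ j ≔ F₀ ])) (det (A [ j ≔ F₀ ])))))) ⟩
    p₀ * det (A [ j ≔ F₀ ]) + det (A [ j ≔ R ])
      ≡⟨ cong (λ z → p₀ * det (A [ j ≔ F₀ ]) + z) (det-column-sum (p ∘ Fin.suc) (F ∘ Fin.suc)) ⟩
    p₀ * det (A [ j ≔ F₀ ]) + sum (λ k → p (Fin.suc k) * det (A [ j ≔ F (Fin.suc k) ])) ∎
    where
    p₀ : ℚ
    p₀ = p Fin.zero
    F₀ R : Fin n → ℚ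
    F₀ = F Fin.zero
    R i = sum (λ k → p (Fin.suc k) * F (Fin.suc k) i)
    pad : ∀ a b → a ≡ a + 0ℚ * b
    pad = solve-∀ ℚ-ring

-- A column equal to a non-adjacent one is moved next to it by expanding the vanishing
-- determinant whose columns l and l + 1 are both the sum of the two original ones.
det-equalColumns-gap : ∀ {n} m (j l : Fin n) {A : Matrix n} → toℕ l ≡ m → toℕ j ℕ.< toℕ l →
  (∀ i → A i j ≡ A i l) → det A ≡ 0ℚ
det-equalColumns-gap (suc m) j (Fin.suc l) {A} l≡m j<l eq with j Fin.≟ inject₁ l
... | yes refl = det-adjacentEqual l {A} eq
... | no j≢l = begin
  det A                       ≡⟨ det-cong A≡M ⟩
  D a c                       ≡⟨ solved (D a c) (D c c) (D a a) (D c a) Daa≡0 Dcc≡0 Dca≡0 both ⟩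
  0ℚ                          ∎
  where
  lˡ lʳ : Fin _
  lˡ = inject₁ l
  lʳ = Fin.suc l
  a c : Fin _ → ℚ
  a i = A i lˡ
  c i = A i lʳ
  M : (x y : Fin _ → ℚ) → Matrix _
  M x y = A [ lˡ ≔ x ] [ lʳ ≔ y ]
  D : (x y : Fin _ → ℚ) → ℚ
  D x y = det (M x y)
  lˡ≢lʳ : lˡ ≢ lʳ
  lˡ≢lʳ p = ℕ.<-irrefl (trans (sym (Fin.toℕ-inject₁ l)) (cong toℕ p)) (ℕ.n<1+n _)
  j≢lʳ : j ≢ lʳ
  j≢lʳ p = ℕ.<-irrefl (cong toℕ p) j<l
  j<lˡ : toℕ j ℕ.< toℕ lˡ
  j<lˡ = ℕ.≤∧≢⇒< (subst (toℕ j ℕ.≤_) (sym (Fin.toℕ-inject₁ l)) (ℕ.s≤s⁻¹ j<l)) (j≢l ∘ Fin.toℕ-injective)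
  M-l : ∀ x y i → M x y i lˡ ≡ x i
  M-l x y i = trans (column-other (A [ lˡ ≔ x ]) lʳ y i lˡ lˡ≢lʳ) (column-updated A lˡ x i)
  M-r : ∀ x y i → M x y i lʳ ≡ y i
  M-r x y i = column-updated (A [ lˡ ≔ x ]) lʳ y i
  M-other : ∀ x y i k → k ≢ lˡ → k ≢ lʳ → M x y i k ≡ A i k
  M-other x y i k p q = trans (column-other (A [ lˡ ≔ x ]) lʳ y i k q) (column-other A lˡ x i k p)
  A≡M : ∀ i k → A i k ≡ M a c i k
  A≡M i k with k Fin.≟ lʳ | k Fin.≟ lˡ
  ... | yes refl | _        = sym (M-r a c i)
  ... | no p     | yes refl = sym (M-l a c i)
  ... | no p     | no q     = sym (M-other a c i k q p)
  diagonal : ∀ x → D x x ≡ 0ℚ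
  diagonal x = det-adjacentEqual l {M x x} λ i → trans (M-l x x i) (sym (M-r x x i))
  Daa≡0 : D a a ≡ 0ℚ
  Daa≡0 = diagonal a
  Dcc≡0 : D c c ≡ 0ℚ
  Dcc≡0 = diagonal c
  -- After the exchange the column equal to column `j` sits one place further left, so the recursion
  -- on `m` applies.
  Dca≡0 : D c a ≡ 0ℚ
  Dca≡0 = det-equalColumns-gap m j lˡ {M c a}
    (trans (Fin.toℕ-inject₁ l) (ℕ.suc-injective l≡m)) j<lˡ
    (λ i → trans (M-other c a i j j≢l j≢lʳ) (trans (eq i) (sym (M-l c a i))))
  a+c : Fin _ → ℚ
  a+c i = a i + c i
  +-left : ∀ y → D a+c y ≡ D a y + D c y
  +-left y = trans (det-linear lˡ 1ℚ 1ℚ {M a y} {M c y} {M a+c y} (agree a) (agree c) at-lˡ)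
    (sym (ones (D a y) (D c y)))
    where
    ones : ∀ a b → a + b ≡ 1ℚ * a + 1ℚ * b
    ones = solve-∀ ℚ-ring
    agree : ∀ x i k → k ≢ lˡ → M a+c y i k ≡ M x y i k
    agree x i k p with k Fin.≟ lʳ
    ... | yes refl = trans (M-r a+c y i) (sym (M-r x y i))
    ... | no q     = trans (M-other a+c y i k p q) (sym (M-other x y i k p q))
    at-lˡ : ∀ i → M a+c y i lˡ ≡ 1ℚ * M a y i lˡ + 1ℚ * M c y i lˡ
    at-lˡ i = trans (M-l a+c y i) (trans (ones (a i) (c i))
      (sym (cong₂ (λ p q → 1ℚ * p + 1ℚ * q) (M-l a y i) (M-l c y i))))
  both : (D a a + D c a) + (D a c + D c c) ≡ 0ℚ
  both = begin
    (D a a + D c a) + (D a c + D c c)  ≡⟨ cong₂ _+_ (+-left a) (+-left c) ⟨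
    D a+c a + D a+c c                  ≡⟨ det-column-+ (A [ lˡ ≔ a+c ]) lʳ a c ⟨
    D a+c a+c                          ≡⟨ diagonal a+c ⟩
    0ℚ                                 ∎
  solved : ∀ x y z w → z ≡ 0ℚ → y ≡ 0ℚ → w ≡ 0ℚ → (z + w) + (x + y) ≡ 0ℚ → x ≡ 0ℚ
  solved x _ _ _ refl refl refl p = trans (zeros x) p
    where
    zeros : ∀ x → x ≡ (0ℚ + 0ℚ) + (x + 0ℚ)
    zeros = solve-∀ ℚ-ring

det-equalColumns : ∀ {n} (j l : Fin n) {A : Matrix n} → j ≢ l → (∀ i → A i j ≡ A i l) → det A ≡ 0ℚ
det-equalColumns j l {A} j≢l eq with ℕ.<-cmp (toℕ j) (toℕ l)
... | tri< j<l _ _ = det-equalColumns-gap _ j l {A} refl j<l eq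
... | tri≈ _ j≡l _ = contradiction (Fin.toℕ-injective j≡l) j≢l
... | tri> _ _ l<j = det-equalColumns-gap _ l j {A} refl l<j (sym ∘ eq)

-- Expanding the new column linearly, each term with `k ≢ j` has columns `k` and `j` equal and
-- vanishes.
det-combineColumns : ∀ {n} (A : Matrix n) j (p : Fin n → ℚ) →
  det (A [ j ≔ (λ i → sum (λ k → p k * A i k)) ]) ≡ p j * det A
det-combineColumns A j p = begin
  det (A [ j ≔ (λ i → sum (λ k → p k * A i k)) ])
    ≡⟨ det-column-sum A j p (λ k i → A i k) ⟩
  sum (λ k → p k * D k)
    ≡⟨ sum-single (λ k → p k * D k) j others ⟩
  p j * D j
    ≡⟨ cong (λ z → p j * z) (det-cong unchanged) ⟩
  p j * det A ∎
  where
  D : Fin _ → ℚ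
  D k = det (A [ j ≔ (λ i → A i k) ])
  others : ∀ k → k ≢ j → p k * D k ≡ 0ℚ
  others k k≢j = trans (cong (λ z → p k * z)
    (det-equalColumns k j {A [ j ≔ (λ i → A i k) ]} k≢j λ i →
      trans (column-other A j (λ i → A i k) i k k≢j) (sym (column-updated A j (λ i → A i k) i))))
    (*-zeroʳ (p k))
  unchanged : ∀ i k → (A [ j ≔ (λ i → A i j) ]) i k ≡ A i k
  unchanged i k with k Fin.≟ j
  ... | yes refl = column-updated A j (λ i → A i j) i
  ... | no k≢j   = column-other A j (λ i → A i j) i k k≢j

-- Expansion along the last column

punchIn-inject₁-fromℕ : ∀ {n} (k : Fin (suc n)) → punchIn (inject₁ k) (fromℕ n) ≡ fromℕ (suc n)
punchIn-inject₁-fromℕ Fin.zero = refl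
punchIn-inject₁-fromℕ {suc n} (Fin.suc k) = cong Fin.suc (punchIn-inject₁-fromℕ k)

punchIn-inject₁-inject₁ : ∀ {n} (k : Fin (suc n)) j →
  punchIn (inject₁ k) (inject₁ j) ≡ inject₁ (punchIn k j)
punchIn-inject₁-inject₁ Fin.zero j = refl
punchIn-inject₁-inject₁ (Fin.suc k) Fin.zero = refl
punchIn-inject₁-inject₁ (Fin.suc k) (Fin.suc j) = cong Fin.suc (punchIn-inject₁-inject₁ k j)

punchIn-fromℕ : ∀ {n} (j : Fin n) → punchIn (fromℕ n) j ≡ inject₁ j
punchIn-fromℕ Fin.zero = refl
punchIn-fromℕ (Fin.suc j) = cong Fin.suc (punchIn-fromℕ j)

-- Induction on `r`. If `r` is the first row, only the last Laplace term survives. Otherwise that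
-- term is zero because its entry is, and in all other minors the last column stays last and keeps a
-- single possibly nonzero entry, one row higher.
det-lastColumn : ∀ {n} (A : Matrix (suc n)) r → (∀ i → i ≢ r → A i (fromℕ n) ≡ 0ℚ) →
  det A ≡ (- 1ℚ) ^ (toℕ r ℕ.+ n) * A r (fromℕ n) * det (λ i j → A (punchIn r i) (inject₁ j))
det-lastColumn {n} A Fin.zero A≡0 = begin
  det A
    ≡⟨ sum-single (laplaceTerm A) (fromℕ n) others ⟩
  (- 1ℚ) ^ toℕ (fromℕ n) * A Fin.zero (fromℕ n) * det (minor A (fromℕ n))
    ≡⟨ cong₂ (λ m d → (- 1ℚ) ^ m * A Fin.zero (fromℕ n) * d) (Fin.toℕ-fromℕ n)
         (det-cong λ i j → cong (A (Fin.suc i)) (punchIn-fromℕ j)) ⟩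
  (- 1ℚ) ^ n * A Fin.zero (fromℕ n) * det (λ i j → A (Fin.suc i) (inject₁ j)) ∎
  where
  others : ∀ k → k ≢ fromℕ n → laplaceTerm A k ≡ 0ℚ
  others k k≢n = trans
    (cong (λ z → (- 1ℚ) ^ toℕ k * A Fin.zero k * z)
      (det-zeroColumn (punchOut k≢n) {minor A k} λ i →
        trans (cong (A (Fin.suc i)) (punchIn-punchOut k≢n)) (A≡0 (Fin.suc i) λ ())))
    (*-zeroʳ ((- 1ℚ) ^ toℕ k * A Fin.zero k))
det-lastColumn {suc n} A (Fin.suc r) A≡0 = begin
  det A
    ≡⟨ sum-init-last (laplaceTerm A) ⟩
  sum (λ k → laplaceTerm A (inject₁ k)) + laplaceTerm A last
    ≡⟨ cong₂ _+_ (sum-cong-≗ term) vanishing ⟩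
  sum (λ k → t * laplaceTerm B k) + 0ℚ
    ≡⟨ +-identityʳ _ ⟩
  sum (λ k → t * laplaceTerm B k)
    ≡⟨ *-distribˡ-sum t (laplaceTerm B) ⟨
  t * det B ∎
  where
  last : Fin (suc (suc n))
  last = fromℕ (suc n)
  B : Matrix (suc n)
  B i j = A (punchIn (Fin.suc r) i) (inject₁ j)
  t : ℚ
  t = (- 1ℚ) ^ (suc (toℕ r) ℕ.+ suc n) * A (Fin.suc r) last
  vanishing : laplaceTerm A last ≡ 0ℚ
  vanishing = trans
    (cong (λ z → (- 1ℚ) ^ toℕ last * z * det (minor A last)) (A≡0 Fin.zero λ ()))
    (zeros ((- 1ℚ) ^ toℕ last) (det (minor A last)))
    where
    zeros : ∀ s d → s * 0ℚ * d ≡ 0ℚ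
    zeros = solve-∀ ℚ-ring
  -- Passing from the minor back to `A` raises both the row and the column index of the entry by
  -- one, hence two extra signs.
  rearrange : ∀ s a σ h d → s * a * (σ * h * d) ≡ - 1ℚ * (- 1ℚ * σ) * h * (s * a * d)
  rearrange = solve-∀ ℚ-ring
  term : ∀ k → laplaceTerm A (inject₁ k) ≡ t * laplaceTerm B k
  term k = begin
    (- 1ℚ) ^ toℕ (inject₁ k) * a * det (minor A (inject₁ k))
      ≡⟨ cong₂ (λ m d → (- 1ℚ) ^ m * a * d) (Fin.toℕ-inject₁ k)
           (det-lastColumn (minor A (inject₁ k)) r λ i i≢r →
             trans (cong (A (Fin.suc i)) (punchIn-inject₁-fromℕ k))
                   (A≡0 (Fin.suc i) (i≢r ∘ Fin.suc-injective))) ⟩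
    (- 1ℚ) ^ toℕ k * a * ((- 1ℚ) ^ (toℕ r ℕ.+ n) * A (Fin.suc r) (punchIn (inject₁ k) (fromℕ n))
      * det (λ i j → A (Fin.suc (punchIn r i)) (punchIn (inject₁ k) (inject₁ j))))
      ≡⟨ cong₂ (λ l d → (- 1ℚ) ^ toℕ k * a * ((- 1ℚ) ^ (toℕ r ℕ.+ n) * A (Fin.suc r) l * d))
           (punchIn-inject₁-fromℕ k)
           (det-cong λ i j → cong (A (Fin.suc (punchIn r i))) (punchIn-inject₁-inject₁ k j)) ⟩
    (- 1ℚ) ^ toℕ k * a * ((- 1ℚ) ^ (toℕ r ℕ.+ n) * A (Fin.suc r) last * det (minor B k))
      ≡⟨ rearrange ((- 1ℚ) ^ toℕ k) a ((- 1ℚ) ^ (toℕ r ℕ.+ n)) _ _ ⟩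
    (- 1ℚ) ^ (suc (suc (toℕ r ℕ.+ n))) * A (Fin.suc r) last * laplaceTerm B k
      ≡⟨ cong (λ m → (- 1ℚ) ^ suc m * A (Fin.suc r) last * laplaceTerm B k) (ℕ.+-suc (toℕ r) n) ⟨
    t * laplaceTerm B k ∎
    where
    a : ℚ
    a = A Fin.zero (inject₁ k)

-- Natural numbers as rationals

ι : ℕ → ℚ
ι n = + n / 1

-- Normalised fractions with variable numerators do not compute, so the equality is checked on
-- unnormalised fractions and carried back by `fromℚᵘ`.
ι-+ : ∀ m n → ι (m ℕ.+ n) ≡ ι m + ι n
ι-+ m n = begin
  fromℚᵘ (ℚᵘ.mkℚᵘ (+ (m ℕ.+ n)) 0)
    ≡⟨ fromℚᵘ-cong {ℚᵘ.mkℚᵘ (+ (m ℕ.+ n)) 0} {p ℚᵘ.+ q} (ℚᵘ.*≡* (cong (ℤ._* + 1) (sym (cong₂ ℤ._+_ (ℤ.*-identityʳ (+ m)) (ℤ.*-identityʳ (+ n)))))) ⟩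
  fromℚᵘ (p ℚᵘ.+ q)
    ≡⟨ fromℚᵘ-cong (ℚᵘ.≃-sym (ℚᵘ.≃-trans (toℚᵘ-homo-+ (ι m) (ι n))
         (ℚᵘ.+-cong (toℚᵘ-fromℚᵘ p) (toℚᵘ-fromℚᵘ q)))) ⟩
  fromℚᵘ (toℚᵘ (ι m + ι n))
    ≡⟨ fromℚᵘ-toℚᵘ _ ⟩
  ι m + ι n ∎
  where
  p q : ℚᵘ.ℚᵘ
  p = ℚᵘ.mkℚᵘ (+ m) 0
  q = ℚᵘ.mkℚᵘ (+ n) 0

/-cancel : ∀ i d .{{_ : ℕ.NonZero d}} → ι d * (i / d) ≡ i / 1
/-cancel i (suc d) = begin
  ι (suc d) * (i / suc d)
    ≡⟨ fromℚᵘ-toℚᵘ _ ⟨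
  fromℚᵘ (toℚᵘ (ι (suc d) * (i / suc d)))
    ≡⟨ fromℚᵘ-cong (ℚᵘ.≃-trans (toℚᵘ-homo-* (ι (suc d)) (i / suc d))
         (ℚᵘ.*-cong (toℚᵘ-fromℚᵘ p) (toℚᵘ-fromℚᵘ q))) ⟩
  fromℚᵘ (p ℚᵘ.* q)
    ≡⟨ fromℚᵘ-cong {p ℚᵘ.* q} {ℚᵘ.mkℚᵘ i 0} (ℚᵘ.*≡* (trans (ℤ.*-identityʳ (+ suc d ℤ.* i)) (trans (ℤ.*-comm (+ suc d) i)
         (cong (λ z → i ℤ.* + suc z) (sym (ℕ.+-identityʳ d)))))) ⟩
  i / 1 ∎
  where
  p q : ℚᵘ.ℚᵘ
  p = ℚᵘ.mkℚᵘ (+ suc d) 0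
  q = ℚᵘ.mkℚᵘ i d

ι-* : ∀ m n → ι (m ℕ.* n) ≡ ι m * ι n
ι-* zero    n = sym (*-zeroˡ (ι n))
ι-* (suc m) n = begin
  ι (n ℕ.+ m ℕ.* n)      ≡⟨ ι-+ n (m ℕ.* n) ⟩
  ι n + ι (m ℕ.* n)      ≡⟨ cong (λ z → ι n + z) (ι-* m n) ⟩
  ι n + ι m * ι n        ≡⟨ distrib (ι m) (ι n) ⟩
  (1ℚ + ι m) * ι n       ≡⟨ cong (_* ι n) (ι-+ 1 m) ⟨
  ι (suc m) * ι n        ∎
  where
  distrib : ∀ m n → n + m * n ≡ (1ℚ + m) * n
  distrib = solve-∀ ℚ-ring

*-cancelˡ : ∀ {x y z} → x ≢ 0ℚ → x * y ≡ x * z → y ≡ z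
*-cancelˡ {x} {y} {z} x≢0 eq = begin
  y                ≡⟨ unit y ⟩
  1/ x * (x * y)   ≡⟨ cong (1/ x *_) eq ⟩
  1/ x * (x * z)   ≡⟨ unit z ⟨
  z                ∎
  where
  instance _ = ≢-nonZero x≢0
  unit : ∀ y → y ≡ 1/ x * (x * y)
  unit y = sym (trans (sym (*-assoc (1/ x) x y)) (trans (cong (_* y) (*-inverseˡ x)) (*-identityˡ y)))

ι≢0 : ∀ n .{{_ : ℕ.NonZero n}} → ι n ≢ 0ℚ
ι≢0 n eq = 1≢0 (begin
  1ℚ                  ≡⟨ /-cancel (+ 1) n ⟨
  ι n * (+ 1 / n)     ≡⟨ cong (_* (+ 1 / n)) eq ⟩
  0ℚ * (+ 1 / n)      ≡⟨ *-zeroˡ (+ 1 / n) ⟩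
  0ℚ                  ∎)

-- Formal power series

-- `S` removes the constant term and divides by t; `D` is d/dt.
S D : Series → Series
S f n = f (suc n)
D f n = ι (suc n) * f (suc n)

infixr 8 _·_
_·_ : ℚ → Series → Series
(x · f) n = x * f n

⊛-cong : ∀ {f f′ g g′} → f ≗ f′ → g ≗ g′ → f ⊛ g ≗ f′ ⊛ g′
⊛-cong p q n = sum-cong-≗ {suc n} λ k → cong₂ _*_ (p (toℕ k)) (q (n ℕ.∸ toℕ k))

-- Convolution is handled through f ⊛ g = f₀ g + t (S f ⊛ g), which holds definitionally
-- at each positive coefficient.
⊛-linearˡ : ∀ x y f g h → (x · f ⊕ y · g) ⊛ h ≗ x · (f ⊛ h) ⊕ y · (g ⊛ h)
⊛-linearˡ x y f g h zero = lemma x y (f 0) (g 0) (h 0)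
  where
  lemma : ∀ x y f g h → (x * f + y * g) * h + 0ℚ ≡ x * (f * h + 0ℚ) + y * (g * h + 0ℚ)
  lemma = solve-∀ ℚ-ring
⊛-linearˡ x y f g h (suc n) = trans
  (cong (λ z → (x * f 0 + y * g 0) * h (suc n) + z) (⊛-linearˡ x y (S f) (S g) h n))
  (lemma x y (f 0) (g 0) (h (suc n)) ((S f ⊛ h) n) ((S g ⊛ h) n))
  where
  lemma : ∀ x y f g h p q → (x * f + y * g) * h + (x * p + y * q)
    ≡ x * (f * h + p) + y * (g * h + q)
  lemma = solve-∀ ℚ-ring

⊛-linearʳ : ∀ x y f g h → f ⊛ (x · g ⊕ y · h) ≗ x · (f ⊛ g) ⊕ y · (f ⊛ h)
⊛-linearʳ x y f g h zero = lemma x y (f 0) (g 0) (h 0)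
  where
  lemma : ∀ x y f g h → f * (x * g + y * h) + 0ℚ ≡ x * (f * g + 0ℚ) + y * (f * h + 0ℚ)
  lemma = solve-∀ ℚ-ring
⊛-linearʳ x y f g h (suc n) = trans
  (cong (λ z → f 0 * (x * g (suc n) + y * h (suc n)) + z) (⊛-linearʳ x y (S f) g h n))
  (lemma x y (f 0) (g (suc n)) (h (suc n)) ((S f ⊛ g) n) ((S f ⊛ h) n))
  where
  lemma : ∀ x y f g h p q → f * (x * g + y * h) + (x * p + y * q)
    ≡ x * (f * g + p) + y * (f * h + q)
  lemma = solve-∀ ℚ-ring

-- Since `S (f ⊛ g)` is `f 0 · S g ⊕ S f ⊛ g`, linearity reduces the claim for `f` to the one for
-- `S f`.
⊛-assoc : ∀ f g h → (f ⊛ g) ⊛ h ≗ f ⊛ (g ⊛ h)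
⊛-assoc f g h zero = lemma (f 0) (g 0) (h 0)
  where
  lemma : ∀ f g h → (f * g + 0ℚ) * h + 0ℚ ≡ f * (g * h + 0ℚ) + 0ℚ
  lemma = solve-∀ ℚ-ring
⊛-assoc f g h (suc n) = begin
  (f 0 * g 0 + 0ℚ) * h (suc n) + (S (f ⊛ g) ⊛ h) n
    ≡⟨ cong (λ z → (f 0 * g 0 + 0ℚ) * h (suc n) + z) (trans
         (⊛-cong {S (f ⊛ g)} {f 0 · S g ⊕ 1ℚ · (S f ⊛ g)} {h}
           (λ k → cong (λ z → f 0 * g (suc k) + z) (sym (*-identityˡ ((S f ⊛ g) k)))) (λ _ → refl) n)
         (⊛-linearˡ (f 0) 1ℚ (S g) (S f ⊛ g) h n)) ⟩
  (f 0 * g 0 + 0ℚ) * h (suc n) + (f 0 * (S g ⊛ h) n + 1ℚ * ((S f ⊛ g) ⊛ h) n)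
    ≡⟨ lemma (f 0) (g 0) (h (suc n)) ((S g ⊛ h) n) (((S f ⊛ g) ⊛ h) n) ⟩
  f 0 * (g 0 * h (suc n) + (S g ⊛ h) n) + ((S f ⊛ g) ⊛ h) n
    ≡⟨ cong (λ z → f 0 * (g ⊛ h) (suc n) + z) (⊛-assoc (S f) g h n) ⟩
  f 0 * (g ⊛ h) (suc n) + (S f ⊛ (g ⊛ h)) n ∎
  where
  lemma : ∀ f g h p q → (f * g + 0ℚ) * h + (f * p + 1ℚ * q) ≡ f * (g * h + p) + q
  lemma = solve-∀ ℚ-ring

⊛-zeroˡ : ∀ f {z} → (∀ n → z n ≡ 0ℚ) → ∀ n → (z ⊛ f) n ≡ 0ℚ
⊛-zeroˡ f {z} z≡0 zero    = trans (cong (λ x → x * f 0 + 0ℚ) (z≡0 0)) (trans (+-identityʳ _) (*-zeroˡ (f 0)))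
⊛-zeroˡ f {z} z≡0 (suc n) = begin
  z 0 * f (suc n) + (S z ⊛ f) n   ≡⟨ cong₂ _+_ (cong (_* f (suc n)) (z≡0 0)) (⊛-zeroˡ f {S z} (z≡0 ∘ suc) n) ⟩
  0ℚ * f (suc n) + 0ℚ             ≡⟨ trans (+-identityʳ _) (*-zeroˡ (f (suc n))) ⟩
  0ℚ                              ∎

⊛-identityˡ : ∀ f → one ⊛ f ≗ f
⊛-identityˡ f zero    = trans (+-identityʳ _) (*-identityˡ (f 0))
⊛-identityˡ f (suc n) = begin
  1ℚ * f (suc n) + (S one ⊛ f) n  ≡⟨ cong₂ _+_ (*-identityˡ (f (suc n))) (⊛-zeroˡ f {S one} (λ _ → refl) n) ⟩
  f (suc n) + 0ℚ                  ≡⟨ +-identityʳ _ ⟩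
  f (suc n)                       ∎

⊛-identityʳ : ∀ f → f ⊛ one ≗ f
⊛-identityʳ f zero    = trans (+-identityʳ _) (*-identityʳ (f 0))
⊛-identityʳ f (suc n) = begin
  f 0 * 0ℚ + (S f ⊛ one) n  ≡⟨ cong₂ _+_ (*-zeroʳ (f 0)) (⊛-identityʳ (S f) n) ⟩
  0ℚ + f (suc n)            ≡⟨ +-identityˡ _ ⟩
  f (suc n)                 ∎

-- The constant coefficient forces `h 0` to vanish; then `S h ⊛ g` is zero as well and the argument
-- repeats.
⊛-cancelʳ : ∀ {g} → g 0 ≢ 0ℚ → ∀ h → (∀ n → (h ⊛ g) n ≡ 0ℚ) → ∀ n → h n ≡ 0ℚ
⊛-cancelʳ {g} g₀≢0 h hg≡0 = go
  where
  h₀≡0 : h 0 ≡ 0ℚ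
  h₀≡0 = *-cancelˡ g₀≢0 (begin
    g 0 * h 0        ≡⟨ *-comm (g 0) (h 0) ⟩
    h 0 * g 0        ≡⟨ +-identityʳ _ ⟨
    h 0 * g 0 + 0ℚ   ≡⟨ hg≡0 0 ⟩
    0ℚ               ≡⟨ *-zeroʳ (g 0) ⟨
    g 0 * 0ℚ         ∎)
  go : ∀ n → h n ≡ 0ℚ
  go zero    = h₀≡0
  go (suc n) = ⊛-cancelʳ g₀≢0 (S h) (λ k → begin
    (S h ⊛ g) k                      ≡⟨ trans (cong (_+ (S h ⊛ g) k) (*-zeroˡ (g (suc k)))) (+-identityˡ _) ⟨
    0ℚ * g (suc k) + (S h ⊛ g) k     ≡⟨ cong (λ z → z * g (suc k) + (S h ⊛ g) k) h₀≡0 ⟨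
    (h ⊛ g) (suc k)                  ≡⟨ hg≡0 (suc k) ⟩
    0ℚ                               ∎) n

-- The derivative of f = f₀ + t·Sf is Sf + t·(Sf)′.
D-as-shift : ∀ f n → D f (suc n) ≡ S f (suc n) + D (S f) n
D-as-shift f n = trans (cong (_* f (suc (suc n))) (ι-+ 1 (suc n))) (lemma (ι (suc n)) (f (suc (suc n))))
  where
  lemma : ∀ m x → (1ℚ + m) * x ≡ x + m * x
  lemma = solve-∀ ℚ-ring

-- Induction on the coefficient through f = f₀ + t·Sf: splitting the index factor as 1 + (n + 1)
-- separates `S f ⊛ g` from its derivative, to which the induction hypothesis applies.
leibniz : ∀ f g → D (f ⊛ g) ≗ D f ⊛ g ⊕ f ⊛ D g
leibniz f g zero = lemma (f 0) (f 1) (g 0) (g 1)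
  where
  lemma : ∀ f₀ f₁ g₀ g₁ → 1ℚ * (f₀ * g₁ + (f₁ * g₀ + 0ℚ)) ≡ (1ℚ * f₁ * g₀ + 0ℚ) + (f₀ * (1ℚ * g₁) + 0ℚ)
  lemma = solve-∀ ℚ-ring
leibniz f g (suc n) = begin
  ι (suc (suc n)) * (f 0 * g (suc (suc n)) + (S f ⊛ g) (suc n))
    ≡⟨ cong (_* (f 0 * g (suc (suc n)) + (S f ⊛ g) (suc n))) (ι-+ 1 (suc n)) ⟩
  (1ℚ + ι (suc n)) * (f 0 * g (suc (suc n)) + (S f ⊛ g) (suc n))
    ≡⟨ split (ι (suc n)) (f 0) (g (suc (suc n))) ((S f ⊛ g) (suc n)) ⟩
  f 0 * ((1ℚ + ι (suc n)) * g (suc (suc n))) + (S f ⊛ g) (suc n) + ι (suc n) * (S f ⊛ g) (suc n)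
    ≡⟨ cong₂ (λ i z → f 0 * (i * g (suc (suc n))) + (S f ⊛ g) (suc n) + z)
         (sym (ι-+ 1 (suc n))) (leibniz (S f) g n) ⟩
  f 0 * D g (suc n) + (f 1 * g (suc n) + (S (S f) ⊛ g) n) + ((D (S f) ⊛ g) n + (S f ⊛ D g) n)
    ≡⟨ regroup (f 0 * D g (suc n)) (f 1) (g (suc n)) ((S (S f) ⊛ g) n) ((D (S f) ⊛ g) n) ((S f ⊛ D g) n) ⟩
  (1ℚ * f 1 * g (suc n) + (1ℚ * (S (S f) ⊛ g) n + 1ℚ * (D (S f) ⊛ g) n)) + (f 0 * D g (suc n) + (S f ⊛ D g) n)
    ≡⟨ cong (λ z → (1ℚ * f 1 * g (suc n) + z) + (f ⊛ D g) (suc n)) (trans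
         (sym (⊛-linearˡ 1ℚ 1ℚ (S (S f)) (D (S f)) g n))
         (⊛-cong {1ℚ · S (S f) ⊕ 1ℚ · D (S f)} {S (D f)} {g}
           (λ k → trans (cong₂ _+_ (*-identityˡ (f (suc (suc k)))) (*-identityˡ (D (S f) k))) (sym (D-as-shift f k)))
           (λ _ → refl) n)) ⟩
  (D f ⊛ g) (suc n) + (f ⊛ D g) (suc n) ∎
  where
  split : ∀ i f g p → (1ℚ + i) * (f * g + p) ≡ f * ((1ℚ + i) * g) + p + i * p
  split = solve-∀ ℚ-ring
  regroup : ∀ a f g p q r → a + (f * g + p) + (q + r) ≡ (1ℚ * f * g + (1ℚ * p + 1ℚ * q)) + (a + r)
  regroup = solve-∀ ℚ-ring

2ℚ : ℚ
2ℚ = 1ℚ + 1ℚ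

-- Powers of tanh (t / 2)

D-exp : D (exp 1ℚ) ≗ exp 1ℚ
D-exp n = begin
  ι (suc n) * (1ℚ * 1ℚ ^ n * r′)  ≡⟨ commute (ι (suc n)) (1ℚ ^ n) r′ ⟩
  1ℚ ^ n * (ι (suc n) * r′)       ≡⟨ cong (1ℚ ^ n *_) (*-cancelˡ (ι≢0 (n !)) both) ⟩
  1ℚ ^ n * r                      ∎
  where
  instance _ = n !≢0
  instance _ = suc n !≢0
  r r′ : ℚ
  r  = + 1 / (n !)
  r′ = + 1 / (suc n !)
  commute : ∀ i p r → i * (1ℚ * p * r) ≡ p * (i * r)
  commute = solve-∀ ℚ-ring
  assoc : ∀ f i r → f * (i * r) ≡ i * f * r
  assoc = solve-∀ ℚ-ring
  both : ι (n !) * (ι (suc n) * r′) ≡ ι (n !) * r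
  both = begin
    ι (n !) * (ι (suc n) * r′)  ≡⟨ assoc (ι (n !)) (ι (suc n)) r′ ⟩
    ι (suc n) * ι (n !) * r′    ≡⟨ cong (_* r′) (ι-* (suc n) (n !)) ⟨
    ι (suc n !) * r′            ≡⟨ /-cancel (+ 1) (suc n !) ⟩
    1ℚ                          ≡⟨ /-cancel (+ 1) (n !) ⟨
    ι (n !) * r                 ∎

-- The series 2eᵗ/(eᵗ + 1), whose n-th coefficient is Eₙ(1)/n!.
g : Series
g = quotient (2e^xt 1ℚ) e^t+1

-- With F = eᵗ + 1: differentiating g F = 2 eᵗ and multiplying it by g both produce g eᵗ;
-- eliminating that term leaves a multiple of F, which cancels.
g-riccati : ∀ n → 2ℚ * D g n ≡ 2ℚ * g n - (g ⊛ g) n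
g-riccati n = isolate (D g n) (g n) ((g ⊛ g) n)
  (⊛-cancelʳ {e^t+1} (λ ()) T T⊛F≡0 n)
  where
  e : Series
  e = exp 1ℚ
  -- This is 2g′ - 2g + g², built from binary linear combinations to fit `⊛-linearˡ`.
  T : Series
  T = 2ℚ · D g ⊕ 1ℚ · ((- 2ℚ) · g ⊕ 1ℚ · (g ⊛ g))
  isolate : ∀ d g q → 2ℚ * d + 1ℚ * (- 2ℚ * g + 1ℚ * q) ≡ 0ℚ → 2ℚ * d ≡ 2ℚ * g - q
  isolate d g q eq = begin
    2ℚ * d                                            ≡⟨ lemma d g q ⟩
    2ℚ * d + 1ℚ * (- 2ℚ * g + 1ℚ * q) + (2ℚ * g - q)  ≡⟨ cong (_+ (2ℚ * g - q)) eq ⟩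
    0ℚ + (2ℚ * g - q)                                 ≡⟨ +-identityˡ _ ⟩
    2ℚ * g - q                                        ∎
    where
    lemma : ∀ d g q → (1ℚ + 1ℚ) * d ≡ (1ℚ + 1ℚ) * d + 1ℚ * (- (1ℚ + 1ℚ) * g + 1ℚ * q) + ((1ℚ + 1ℚ) * g - q)
    lemma = solve-∀ ℚ-ring
  gF : g ⊛ e^t+1 ≗ e ⊕ e
  gF = quotient-⊛ (2e^xt 1ℚ) e^t+1
  DF : D e^t+1 ≗ e
  DF k = trans (cong (ι (suc k) *_) (+-identityʳ (e (suc k)))) (D-exp k)
  differentiated : ∀ k → (D g ⊛ e^t+1) k + (g ⊛ e) k ≡ e k + e k
  differentiated k = begin
    (D g ⊛ e^t+1) k + (g ⊛ e) k
      ≡⟨ cong (λ z → (D g ⊛ e^t+1) k + z) (⊛-cong {g} {g} {D e^t+1} {e} (λ _ → refl) DF k) ⟨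
    (D g ⊛ e^t+1) k + (g ⊛ D e^t+1) k
      ≡⟨ leibniz g e^t+1 k ⟨
    D (g ⊛ e^t+1) k
      ≡⟨ cong (ι (suc k) *_) (gF (suc k)) ⟩
    ι (suc k) * (e (suc k) + e (suc k))
      ≡⟨ *-distribˡ-+ (ι (suc k)) (e (suc k)) (e (suc k)) ⟩
    D e k + D e k
      ≡⟨ cong₂ _+_ (D-exp k) (D-exp k) ⟩
    e k + e k ∎
  multiplied : ∀ k → ((g ⊛ g) ⊛ e^t+1) k ≡ 1ℚ * (g ⊛ e) k + 1ℚ * (g ⊛ e) k
  multiplied k = begin
    ((g ⊛ g) ⊛ e^t+1) k
      ≡⟨ ⊛-assoc g g e^t+1 k ⟩
    (g ⊛ (g ⊛ e^t+1)) k
      ≡⟨ ⊛-cong {g} {g} {g ⊛ e^t+1} {1ℚ · e ⊕ 1ℚ · e} (λ _ → refl)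
           (λ i → trans (gF i) (sym (cong₂ _+_ (*-identityˡ (e i)) (*-identityˡ (e i))))) k ⟩
    (g ⊛ (1ℚ · e ⊕ 1ℚ · e)) k
      ≡⟨ ⊛-linearʳ 1ℚ 1ℚ g e e k ⟩
    1ℚ * (g ⊛ e) k + 1ℚ * (g ⊛ e) k ∎
  T⊛F≡0 : ∀ k → (T ⊛ e^t+1) k ≡ 0ℚ
  T⊛F≡0 k = begin
    (T ⊛ e^t+1) k
      ≡⟨ ⊛-linearˡ 2ℚ 1ℚ (D g) ((- 2ℚ) · g ⊕ 1ℚ · (g ⊛ g)) e^t+1 k ⟩
    2ℚ * X + 1ℚ * (((- 2ℚ) · g ⊕ 1ℚ · (g ⊛ g)) ⊛ e^t+1) k
      ≡⟨ cong (λ z → 2ℚ * X + 1ℚ * z) (⊛-linearˡ (- 2ℚ) 1ℚ g (g ⊛ g) e^t+1 k) ⟩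
    2ℚ * X + 1ℚ * (- 2ℚ * (g ⊛ e^t+1) k + 1ℚ * ((g ⊛ g) ⊛ e^t+1) k)
      ≡⟨ cong₂ (λ a b → 2ℚ * X + 1ℚ * (- 2ℚ * a + 1ℚ * b)) (gF k) (multiplied k) ⟩
    2ℚ * X + 1ℚ * (- 2ℚ * (e k + e k) + 1ℚ * (1ℚ * Y + 1ℚ * Y))
      ≡⟨ cong (λ a → 2ℚ * X + 1ℚ * (- 2ℚ * a + 1ℚ * (1ℚ * Y + 1ℚ * Y))) (differentiated k) ⟨
    2ℚ * X + 1ℚ * (- 2ℚ * (X + Y) + 1ℚ * (1ℚ * Y + 1ℚ * Y))
      ≡⟨ lemma X Y ⟩
    0ℚ ∎
    where
    X Y : ℚ
    X = (D g ⊛ e^t+1) k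
    Y = (g ⊛ e) k
    lemma : ∀ x y → (1ℚ + 1ℚ) * x + 1ℚ * (- (1ℚ + 1ℚ) * (x + y) + 1ℚ * (1ℚ * y + 1ℚ * y)) ≡ 0ℚ
    lemma = solve-∀ ℚ-ring

-- u = tanh (t / 2)
u : Series
u = 1ℚ · g ⊕ (- 1ℚ) · one

u-suc : ∀ n → u (suc n) ≡ g (suc n)
u-suc n = lemma (g (suc n))
  where
  lemma : ∀ x → 1ℚ * x + - 1ℚ * 0ℚ ≡ x
  lemma = solve-∀ ℚ-ring

-- With u = g - 1 one has 2g - g² = 1 - u², while u′ = g′.
u-riccati : ∀ n → 2ℚ * D u n ≡ one n - (u ⊛ u) n
u-riccati n = begin
  2ℚ * D u n
    ≡⟨ cong (λ z → 2ℚ * (ι (suc n) * z)) (u-suc n) ⟩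
  2ℚ * D g n
    ≡⟨ g-riccati n ⟩
  2ℚ * g n - (g ⊛ g) n
    ≡⟨ lemma (g n) ((g ⊛ g) n) (one n) ⟩
  one n - (1ℚ * (1ℚ * (g ⊛ g) n + - 1ℚ * g n) + - 1ℚ * u n)
    ≡⟨ cong (λ z → one n - z) square ⟨
  one n - (u ⊛ u) n ∎
  where
  lemma : ∀ g q o → (1ℚ + 1ℚ) * g - q ≡ o - (1ℚ * (1ℚ * q + - 1ℚ * g) + - 1ℚ * (1ℚ * g + - 1ℚ * o))
  lemma = solve-∀ ℚ-ring
  square : (u ⊛ u) n ≡ 1ℚ * (1ℚ * (g ⊛ g) n + - 1ℚ * g n) + - 1ℚ * u n
  square = begin
    (u ⊛ u) n
      ≡⟨ ⊛-linearˡ 1ℚ (- 1ℚ) g one u n ⟩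
    1ℚ * (g ⊛ u) n + - 1ℚ * (one ⊛ u) n
      ≡⟨ cong₂ (λ a b → 1ℚ * a + - 1ℚ * b)
           (trans (⊛-linearʳ 1ℚ (- 1ℚ) g g one n)
                  (cong (λ z → 1ℚ * (g ⊛ g) n + - 1ℚ * z) (⊛-identityʳ g n)))
           (⊛-identityˡ u n) ⟩
    1ℚ * (1ℚ * (g ⊛ g) n + - 1ℚ * g n) + - 1ℚ * u n ∎

u^ : ℕ → Series
u^ zero    = one
u^ (suc m) = u ⊛ u^ m

-- By Leibniz, (u·uᵐ)′ = u′uᵐ + u(uᵐ)′. The first term is rewritten by 2u′ = 1 - u²; the second is
-- `u-D-power`, which is `u` times the previous case of `D-power`.
D-power : ∀ m n → 2ℚ * D (u^ (suc m)) n ≡ ι (suc m) * (u^ m n - u^ (suc (suc m)) n)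
u-D-power : ∀ m n → 2ℚ * (u ⊛ D (u^ m)) n ≡ ι m * (u^ m n - u^ (suc (suc m)) n)

D-power m n = begin
  2ℚ * D (u ⊛ u^ m) n
    ≡⟨ cong (2ℚ *_) (leibniz u (u^ m) n) ⟩
  2ℚ * ((D u ⊛ u^ m) n + (u ⊛ D (u^ m)) n)
    ≡⟨ split ((D u ⊛ u^ m) n) ((u ⊛ D (u^ m)) n) ⟩
  (1ℚ * (D u ⊛ u^ m) n + 1ℚ * (D u ⊛ u^ m) n) + 2ℚ * (u ⊛ D (u^ m)) n
    ≡⟨ cong₂ _+_ outer (u-D-power m n) ⟩
  (1ℚ * u^ m n + - 1ℚ * u^ (suc (suc m)) n) + ι m * (u^ m n - u^ (suc (suc m)) n)
    ≡⟨ merge (ι m) (u^ m n) (u^ (suc (suc m)) n) ⟩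
  (1ℚ + ι m) * (u^ m n - u^ (suc (suc m)) n)
    ≡⟨ cong (_* (u^ m n - u^ (suc (suc m)) n)) (ι-+ 1 m) ⟨
  ι (suc m) * (u^ m n - u^ (suc (suc m)) n) ∎
  where
  split : ∀ x y → (1ℚ + 1ℚ) * (x + y) ≡ (1ℚ * x + 1ℚ * x) + (1ℚ + 1ℚ) * y
  split = solve-∀ ℚ-ring
  merge : ∀ i x y → (1ℚ * x + - 1ℚ * y) + i * (x - y) ≡ (1ℚ + i) * (x - y)
  merge = solve-∀ ℚ-ring
  twice : ∀ x → 1ℚ * x + 1ℚ * x ≡ (1ℚ + 1ℚ) * x
  twice = solve-∀ ℚ-ring
  signs : ∀ x y → x - y ≡ 1ℚ * x + - 1ℚ * y
  signs = solve-∀ ℚ-ring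
  outer : 1ℚ * (D u ⊛ u^ m) n + 1ℚ * (D u ⊛ u^ m) n ≡ 1ℚ * u^ m n + - 1ℚ * u^ (suc (suc m)) n
  outer = begin
    1ℚ * (D u ⊛ u^ m) n + 1ℚ * (D u ⊛ u^ m) n
      ≡⟨ ⊛-linearˡ 1ℚ 1ℚ (D u) (D u) (u^ m) n ⟨
    ((1ℚ · D u ⊕ 1ℚ · D u) ⊛ u^ m) n
      ≡⟨ ⊛-cong {1ℚ · D u ⊕ 1ℚ · D u} {1ℚ · one ⊕ (- 1ℚ) · (u ⊛ u)} {u^ m}
           (λ k → trans (twice (D u k)) (trans (u-riccati k) (signs (one k) ((u ⊛ u) k))))
           (λ _ → refl) n ⟩
    ((1ℚ · one ⊕ (- 1ℚ) · (u ⊛ u)) ⊛ u^ m) n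
      ≡⟨ ⊛-linearˡ 1ℚ (- 1ℚ) one (u ⊛ u) (u^ m) n ⟩
    1ℚ * (one ⊛ u^ m) n + - 1ℚ * ((u ⊛ u) ⊛ u^ m) n
      ≡⟨ cong₂ (λ a b → 1ℚ * a + - 1ℚ * b) (⊛-identityˡ (u^ m) n) (⊛-assoc u u (u^ m) n) ⟩
    1ℚ * u^ m n + - 1ℚ * u^ (suc (suc m)) n ∎

u-D-power zero n = begin
  2ℚ * (u ⊛ D one) n
    ≡⟨ cong (2ℚ *_) (trans
         (⊛-cong {u} {u} {D one} {0ℚ · one ⊕ 0ℚ · one} (λ _ → refl)
           (λ k → trans (*-zeroʳ (ι (suc k))) (zeros (one k))) n)
         (⊛-linearʳ 0ℚ 0ℚ u one one n)) ⟩
  2ℚ * (0ℚ * (u ⊛ one) n + 0ℚ * (u ⊛ one) n)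
    ≡⟨ vanish ((u ⊛ one) n) (one n - u^ 2 n) ⟩
  0ℚ * (one n - u^ 2 n) ∎
  where
  zeros : ∀ x → 0ℚ ≡ 0ℚ * x + 0ℚ * x
  zeros = solve-∀ ℚ-ring
  vanish : ∀ x y → (1ℚ + 1ℚ) * (0ℚ * x + 0ℚ * x) ≡ 0ℚ * y
  vanish = solve-∀ ℚ-ring
u-D-power (suc m) n = begin
  2ℚ * (u ⊛ D v) n
    ≡⟨ twice ((u ⊛ D v) n) ⟩
  1ℚ * (u ⊛ D v) n + 1ℚ * (u ⊛ D v) n
    ≡⟨ ⊛-linearʳ 1ℚ 1ℚ u (D v) (D v) n ⟨
  (u ⊛ (1ℚ · D v ⊕ 1ℚ · D v)) n
    ≡⟨ ⊛-cong {u} {u} {1ℚ · D v ⊕ 1ℚ · D v} {i · u^ m ⊕ (- i) · u^ (suc (suc m))} (λ _ → refl)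
         (λ k → trans (sym (twice (D v k))) (trans (D-power m k)
           (distrib i (u^ m k) (u^ (suc (suc m)) k)))) n ⟩
  (u ⊛ (i · u^ m ⊕ (- i) · u^ (suc (suc m)))) n
    ≡⟨ ⊛-linearʳ i (- i) u (u^ m) (u^ (suc (suc m))) n ⟩
  i * v n + - i * u^ (suc (suc (suc m))) n
    ≡⟨ distrib i (v n) (u^ (suc (suc (suc m))) n) ⟨
  i * (v n - u^ (suc (suc (suc m))) n) ∎
  where
  v : Series
  v = u^ (suc m)
  i : ℚ
  i = ι (suc m)
  twice : ∀ x → (1ℚ + 1ℚ) * x ≡ 1ℚ * x + 1ℚ * x
  twice = solve-∀ ℚ-ring
  distrib : ∀ i x y → i * (x - y) ≡ i * x + - i * y
  distrib = solve-∀ ℚ-ring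

-- The i-th derivative of uᵐ at 0.
y : ℕ → ℕ → ℚ
y m i = ι (i !) * u^ m i

-- Coefficient `i` of `D-power`, multiplied by i!.
y-rec : ∀ m i → 2ℚ * y (suc m) (suc i) ≡ ι (suc m) * (y m i - y (suc (suc m)) i)
y-rec m i = begin
  2ℚ * (ι (suc i !) * u^ (suc m) (suc i))
    ≡⟨ cong (λ z → 2ℚ * (z * u^ (suc m) (suc i))) (ι-* (suc i) (i !)) ⟩
  2ℚ * (ι (suc i) * ι (i !) * u^ (suc m) (suc i))
    ≡⟨ regroup (ι (suc i)) (ι (i !)) (u^ (suc m) (suc i)) ⟩
  ι (i !) * (2ℚ * D (u^ (suc m)) i)
    ≡⟨ cong (ι (i !) *_) (D-power m i) ⟩
  ι (i !) * (ι (suc m) * (u^ m i - u^ (suc (suc m)) i))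
    ≡⟨ distrib (ι (i !)) (ι (suc m)) (u^ m i) (u^ (suc (suc m)) i) ⟩
  ι (suc m) * (y m i - y (suc (suc m)) i) ∎
  where
  regroup : ∀ i f x → (1ℚ + 1ℚ) * (i * f * x) ≡ f * ((1ℚ + 1ℚ) * (i * x))
  regroup = solve-∀ ℚ-ring
  distrib : ∀ f i x y → f * (i * (x - y)) ≡ i * (f * x - f * y)
  distrib = solve-∀ ℚ-ring

2ℚ≢0 : 2ℚ ≢ 0ℚ
2ℚ≢0 ()

y-suc-zero : ∀ m → y (suc m) 0 ≡ 0ℚ
y-suc-zero m = lemma (u^ m 0)
  where
  lemma : ∀ x → 1ℚ * (0ℚ * x + 0ℚ) ≡ 0ℚ
  lemma = solve-∀ ℚ-ring

-- uᵐ = O(tᵐ), since u vanishes at 0. In `y-rec` both terms on the right again have derivative order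
-- below the exponent.
y-below : ∀ {m i} → i ℕ.< m → y m i ≡ 0ℚ
y-below {suc m} {zero}  _         = y-suc-zero m
y-below {suc m} {suc i} (s≤s i<m) = *-cancelˡ 2ℚ≢0 (begin
  2ℚ * y (suc m) (suc i)                     ≡⟨ y-rec m i ⟩
  ι (suc m) * (y m i - y (suc (suc m)) i)    ≡⟨ cong₂ (λ a b → ι (suc m) * (a - b)) (y-below i<m)
                                                  (y-below (ℕ.m<n⇒m<1+n (ℕ.m<n⇒m<1+n i<m))) ⟩
  ι (suc m) * (0ℚ - 0ℚ)                      ≡⟨ *-zeroʳ (ι (suc m)) ⟩
  2ℚ * 0ℚ                                    ∎)

-- u = t/2 + ..., so uᵐ begins with (t/2)ᵐ.
y-diagonal : ∀ m → ι (2 ℕ.^ m) * y m m ≡ ι (m !)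
y-diagonal zero    = refl
y-diagonal (suc m) = begin
  ι (2 ℕ.^ suc m) * y (suc m) (suc m)
    ≡⟨ cong (_* y (suc m) (suc m)) (ι-* 2 (2 ℕ.^ m)) ⟩
  2ℚ * ι (2 ℕ.^ m) * y (suc m) (suc m)
    ≡⟨ swap (ι (2 ℕ.^ m)) (y (suc m) (suc m)) ⟩
  ι (2 ℕ.^ m) * (2ℚ * y (suc m) (suc m))
    ≡⟨ cong (ι (2 ℕ.^ m) *_) (y-rec m m) ⟩
  ι (2 ℕ.^ m) * (ι (suc m) * (y m m - y (suc (suc m)) m))
    ≡⟨ cong (λ z → ι (2 ℕ.^ m) * (ι (suc m) * (y m m - z))) (y-below (ℕ.m<n⇒m<1+n (ℕ.n<1+n m))) ⟩
  ι (2 ℕ.^ m) * (ι (suc m) * (y m m - 0ℚ))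
    ≡⟨ regroup (ι (2 ℕ.^ m)) (ι (suc m)) (y m m) ⟩
  ι (suc m) * (ι (2 ℕ.^ m) * y m m)
    ≡⟨ cong (ι (suc m) *_) (y-diagonal m) ⟩
  ι (suc m) * ι (m !)
    ≡⟨ ι-* (suc m) (m !) ⟨
  ι (suc m !) ∎
  where
  swap : ∀ p x → (1ℚ + 1ℚ) * p * x ≡ p * ((1ℚ + 1ℚ) * x)
  swap = solve-∀ ℚ-ring
  regroup : ∀ p i x → p * (i * (x - 0ℚ)) ≡ i * (p * x)
  regroup = solve-∀ ℚ-ring

-- Even derivatives of the antiderivatives

-- This form makes `double (suc n)` unfold to two successors, so `y-rec` applies to doubled indices
-- without transport.
double : ℕ → ℕ
double zero    = zero
double (suc n) = suc (suc (double n))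

double≡2* : ∀ n → double n ≡ 2 ℕ.* n
double≡2* zero    = refl
double≡2* (suc n) = cong suc (trans (cong suc (double≡2* n)) (sym (ℕ.+-suc n (n ℕ.+ 0))))

double-mono-< : ∀ {i n} → i ℕ.< n → double i ℕ.< double n
double-mono-< {zero}  (s≤s _)   = s≤s z≤n
double-mono-< {suc i} (s≤s i<n) = s≤s (s≤s (double-mono-< i<n))

ι-double : ∀ n → ι (double n) ≡ 2ℚ * ι n
ι-double n = trans (cong ι (double≡2* n)) (ι-* 2 n)

-- `g` and `u` differ only in the constant term, which an odd index avoids.
b-suc : ∀ i → b (suc i) ≡ y 1 (suc (double i))
b-suc i = begin
  E (2 ℕ.* suc i ℕ.∸ 1) 1ℚ                             ≡⟨ cong (λ m → E (m ℕ.∸ 1) 1ℚ) (double≡2* (suc i)) ⟨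
  ι (suc (double i) !) * g (suc (double i))            ≡⟨ cong (ι (suc (double i) !) *_) (u-suc (double i)) ⟨
  ι (suc (double i) !) * u (suc (double i))            ≡⟨ cong (ι (suc (double i) !) *_) (⊛-identityʳ u (suc (double i))) ⟨
  ι (suc (double i) !) * u^ 1 (suc (double i))         ∎

-- The second Hankel matrix is therefore built from `b` shifted by one place.
E-odd : ∀ k → E (2 ℕ.* k ℕ.+ 1) 1ℚ ≡ b (suc k)
E-odd k = cong (λ m → E m 1ℚ)
  (trans (ℕ.+-comm (2 ℕ.* k) 1) (cong (ℕ._∸ 1) (trans (cong (suc ∘ suc) (sym (double≡2* k))) (double≡2* (suc k)))))

harmonic-suc : ∀ n → harmonic (suc n) ≡ harmonic n + + 1 / suc n
harmonic-suc n = trans (sum-init-last {n} (λ j → + 1 / suc (toℕ j)))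
  (cong₂ _+_ (sum-cong-≗ {n} λ j → cong (λ m → + 1 / suc m) (Fin.toℕ-inject₁ j))
             (cong (λ m → + 1 / suc m) (Fin.toℕ-fromℕ n)))

-- v n i and w n i are the 2i-th derivatives at 0 of the antiderivative of u²ⁿ⁺¹ with constant
-- term harmonic n, and of 1 - u²ⁿ.
v w : ℕ → ℕ → ℚ
v n zero    = harmonic n
v n (suc i) = y (suc (double n)) (suc (double i))
w n i       = one i - y (double n) (double i)

b≡v₀ : ∀ i → b i ≡ v 0 i
b≡v₀ zero    = refl
b≡v₀ (suc i) = b-suc i

w-zero : ∀ i → w 0 i ≡ 0ℚ
w-zero zero    = refl
w-zero (suc i) = cong (λ z → 0ℚ - z) (*-zeroʳ (ι (double (suc i) !)))

-- Even derivatives of (2n+1)(u²ⁿ - u²ⁿ⁺²) = 2(u²ⁿ⁺¹)′. The shift to `suc i` on the right is the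
-- operator (d/dt)².
w-rec : ∀ n i → ι (suc (double n)) * (w (suc n) i - w n i) ≡ 2ℚ * v n (suc i)
w-rec n i = trans (cancel (ι (suc (double n))) (one i) (y (double n) (double i)) (y (double (suc n)) (double i)))
  (sym (y-rec (double n) (double i)))
  where
  cancel : ∀ m o x z → m * ((o - z) - (o - x)) ≡ m * (x - z)
  cancel = solve-∀ ℚ-ring

-- Differentiating 1 - u²ⁿ⁺² gives (n+1)(u²ⁿ⁺³ - u²ⁿ⁺¹). At `i = 0` the constants of integration
-- must differ by 1/(n+1), which is where the harmonic numbers come from.
v-rec : ∀ n i → ι (suc n) * (v (suc n) i - v n i) ≡ w (suc n) i
v-rec n zero = begin
  ι (suc n) * (harmonic (suc n) - harmonic n)
    ≡⟨ cong (λ h → ι (suc n) * (h - harmonic n)) (harmonic-suc n) ⟩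
  ι (suc n) * (harmonic n + + 1 / suc n - harmonic n)
    ≡⟨ cancel (ι (suc n)) (harmonic n) (+ 1 / suc n) ⟩
  ι (suc n) * (+ 1 / suc n)
    ≡⟨ /-cancel (+ 1) (suc n) ⟩
  1ℚ
    ≡⟨ cong (λ z → 1ℚ - z) (y-suc-zero (suc (double n))) ⟨
  w (suc n) zero ∎
  where
  cancel : ∀ m h x → m * (h + x - h) ≡ m * x
  cancel = solve-∀ ℚ-ring
v-rec n (suc i) = *-cancelˡ 2ℚ≢0 (begin
  2ℚ * (ι (suc n) * (z - x))             ≡⟨ regroup (ι (suc n)) x z ⟩
  - (2ℚ * ι (suc n) * (x - z))           ≡⟨ cong (λ m → - (m * (x - z))) (ι-double (suc n)) ⟨
  - (ι (double (suc n)) * (x - z))       ≡⟨ cong -_ (y-rec (suc (double n)) (suc (double i))) ⟨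
  - (2ℚ * y (double (suc n)) (double (suc i)))  ≡⟨ negate (y (double (suc n)) (double (suc i))) ⟩
  2ℚ * w (suc n) (suc i)                 ∎)
  where
  x z : ℚ
  x = v n (suc i)
  z = v (suc n) (suc i)
  regroup : ∀ m x z → (1ℚ + 1ℚ) * (m * (z - x)) ≡ - ((1ℚ + 1ℚ) * m * (x - z))
  regroup = solve-∀ ℚ-ring
  negate : ∀ y → - ((1ℚ + 1ℚ) * y) ≡ (1ℚ + 1ℚ) * (0ℚ - y)
  negate = solve-∀ ℚ-ring

-- Orthogonal polynomials and Hankel determinants

-- Series also serve as polynomials in x = (d/dt)²; `X` multiplies by x.
X : Series → Series
X f zero    = 0ℚ
X f (suc k) = f k

-- `p n` and `q n` are the polynomials that send W to the functions behind `v n` and `w n`. Their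
-- recursions are `v-rec` and `w-rec` solved for the higher index.
p q : ℕ → Series
p zero        = one
p (suc n) k   = p n k + (+ 1 / suc n) * q (suc n) k
q zero k      = 0ℚ
q (suc n) k   = q n k + (+ 2 / suc (double n)) * X (p n) k

-- The functional xᵏ ↦ s (i + k) applied to f, truncated to degrees below N.
apply : ℕ → Series → (ℕ → ℚ) → ℕ → ℚ
apply N f s i = sum {N} (λ k → f (toℕ k) * s (i ℕ.+ toℕ k))

apply-+ : ∀ N x f g s i → apply N (λ k → f k + x * g k) s i ≡ apply N f s i + x * apply N g s i
apply-+ N x f g s i = begin
  apply N (λ k → f k + x * g k) s i
    ≡⟨ sum-cong-≗ {N} (λ k → distrib x (f (toℕ k)) (g (toℕ k)) (s (i ℕ.+ toℕ k))) ⟩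
  sum {N} (λ k → f (toℕ k) * s (i ℕ.+ toℕ k) + x * (g (toℕ k) * s (i ℕ.+ toℕ k)))
    ≡⟨ ∑-distrib-+ {N} (λ k → f (toℕ k) * s (i ℕ.+ toℕ k)) (λ k → x * (g (toℕ k) * s (i ℕ.+ toℕ k))) ⟩
  apply N f s i + sum {N} (λ k → x * (g (toℕ k) * s (i ℕ.+ toℕ k)))
    ≡⟨ cong (λ z → apply N f s i + z) (*-distribˡ-sum {N} x (λ k → g (toℕ k) * s (i ℕ.+ toℕ k))) ⟨
  apply N f s i + x * apply N g s i ∎
  where
  distrib : ∀ x f g s → (f + x * g) * s ≡ f * s + x * (g * s)
  distrib = solve-∀ ℚ-ring

apply-X : ∀ N f s i → apply (suc N) (X f) s i ≡ apply N f s (suc i)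
apply-X N f s i = begin
  0ℚ * s (i ℕ.+ 0) + sum {N} (λ k → f (toℕ k) * s (i ℕ.+ suc (toℕ k)))
    ≡⟨ cong₂ _+_ (*-zeroˡ (s (i ℕ.+ 0)))
         (sum-cong-≗ {N} λ k → cong (λ m → f (toℕ k) * s m) (ℕ.+-suc i (toℕ k))) ⟩
  0ℚ + apply N f s (suc i)
    ≡⟨ +-identityˡ _ ⟩
  apply N f s (suc i) ∎

apply-zero : ∀ N {f} s i → (∀ k → f k ≡ 0ℚ) → apply N f s i ≡ 0ℚ
apply-zero N s i f≡0 = sum-zero {N} λ k →
  trans (cong (_* s (i ℕ.+ toℕ k)) (f≡0 (toℕ k))) (*-zeroˡ (s (i ℕ.+ toℕ k)))

-- Simultaneous induction with `apply-q` along the recursions of `p` and `q`. The truncation `N`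
-- stays variable because `apply-X` lowers it by one.
apply-p : ∀ n {N} → n ℕ.< N → ∀ i → apply N (p n) b i ≡ v n i
apply-q : ∀ n {N} → n ℕ.< N → ∀ i → apply N (q n) b i ≡ w n i

apply-p zero {suc N} _ i = begin
  1ℚ * b (i ℕ.+ 0) + sum {N} (λ k → 0ℚ * b (i ℕ.+ suc (toℕ k)))
    ≡⟨ cong₂ _+_ (trans (*-identityˡ (b (i ℕ.+ 0))) (cong b (ℕ.+-identityʳ i)))
         (sum-zero {N} λ k → *-zeroˡ (b (i ℕ.+ suc (toℕ k)))) ⟩
  b i + 0ℚ
    ≡⟨ +-identityʳ (b i) ⟩
  b i
    ≡⟨ b≡v₀ i ⟩
  v 0 i ∎
apply-p (suc n) {N} n<N i = *-cancelˡ (ι≢0 (suc n)) (begin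
  ι (suc n) * apply N (p (suc n)) b i
    ≡⟨ cong (ι (suc n) *_) (apply-+ N r (p n) (q (suc n)) b i) ⟩
  ι (suc n) * (apply N (p n) b i + r * apply N (q (suc n)) b i)
    ≡⟨ cong₂ (λ a c → ι (suc n) * (a + r * c)) (apply-p n (ℕ.<-trans (ℕ.n<1+n n) n<N) i) (apply-q (suc n) n<N i) ⟩
  ι (suc n) * (v n i + r * w (suc n) i)
    ≡⟨ regroup (ι (suc n)) (v n i) r (w (suc n) i) ⟩
  ι (suc n) * v n i + ι (suc n) * r * w (suc n) i
    ≡⟨ cong₂ (λ m c → ι (suc n) * v n i + m * c) (/-cancel (+ 1) (suc n)) (sym (v-rec n i)) ⟩
  ι (suc n) * v n i + 1ℚ * (ι (suc n) * (v (suc n) i - v n i))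
    ≡⟨ cancel (ι (suc n)) (v n i) (v (suc n) i) ⟩
  ι (suc n) * v (suc n) i ∎)
  where
  r : ℚ
  r = + 1 / suc n
  regroup : ∀ m v r w → m * (v + r * w) ≡ m * v + m * r * w
  regroup = solve-∀ ℚ-ring
  cancel : ∀ m x z → m * x + 1ℚ * (m * (z - x)) ≡ m * z
  cancel = solve-∀ ℚ-ring

apply-q zero {N} _ i = trans (apply-zero N b i λ _ → refl) (sym (w-zero i))
apply-q (suc n) {suc N} (s≤s n<N) i = *-cancelˡ (ι≢0 m) (begin
  ι m * apply (suc N) (q (suc n)) b i
    ≡⟨ cong (ι m *_) (apply-+ (suc N) r (q n) (X (p n)) b i) ⟩
  ι m * (apply (suc N) (q n) b i + r * apply (suc N) (X (p n)) b i)
    ≡⟨ cong₂ (λ a c → ι m * (a + r * c)) (apply-q n (ℕ.m<n⇒m<1+n n<N) i)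
         (trans (apply-X N (p n) b i) (apply-p n n<N (suc i))) ⟩
  ι m * (w n i + r * v n (suc i))
    ≡⟨ regroup (ι m) (w n i) r (v n (suc i)) ⟩
  ι m * w n i + ι m * r * v n (suc i)
    ≡⟨ cong (λ z → ι m * w n i + z) (trans (cong (_* v n (suc i)) (/-cancel (+ 2) m)) (sym (w-rec n i))) ⟩
  ι m * w n i + ι m * (w (suc n) i - w n i)
    ≡⟨ cancel (ι m) (w n i) (w (suc n) i) ⟩
  ι m * w (suc n) i ∎)
  where
  m : ℕ
  m = suc (double n)
  r : ℚ
  r = + 2 / m
  regroup : ∀ m v r w → m * (v + r * w) ≡ m * v + m * r * w
  regroup = solve-∀ ℚ-ring
  cancel : ∀ m x z → m * x + m * (z - x) ≡ m * z
  cancel = solve-∀ ℚ-ring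

p-degree : ∀ n {k} → n ℕ.< k → p n k ≡ 0ℚ
q-degree : ∀ n {k} → n ℕ.< k → q n k ≡ 0ℚ

p-degree zero    {suc k} _ = refl
p-degree (suc n) {k} n<k = trans
  (cong₂ (λ a c → a + (+ 1 / suc n) * c) (p-degree n (ℕ.<-trans (ℕ.n<1+n n) n<k)) (q-degree (suc n) n<k))
  (trans (+-identityˡ _) (*-zeroʳ (+ 1 / suc n)))

q-degree zero    _ = refl
q-degree (suc n) {suc k} (s≤s n<k) = trans
  (cong₂ (λ a c → a + (+ 2 / suc (double n)) * c) (q-degree n (ℕ.m<n⇒m<1+n n<k)) (p-degree n n<k))
  (trans (+-identityˡ _) (*-zeroʳ (+ 2 / suc (double n))))

-- Each step multiplies the leading coefficient by 2/((n+1)(2n+1)), the lower-order polynomials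
-- contributing nothing in the new degree.
p-leading : ∀ n → p n n ≢ 0ℚ
p-leading zero    ()
p-leading (suc n) eq = p-leading n (*-cancelˡ 2ℚ≢0 (begin
  2ℚ * p n n
    ≡⟨ cong (_* p n n) (/-cancel (+ 2) m) ⟨
  ι m * r * p n n
    ≡⟨ cong (_* p n n) (*-identityˡ (ι m * r)) ⟨
  1ℚ * (ι m * r) * p n n
    ≡⟨ cong (λ z → z * (ι m * r) * p n n) (/-cancel (+ 1) (suc n)) ⟨
  ι (suc n) * s * (ι m * r) * p n n
    ≡⟨ regroup (ι (suc n)) s (ι m) r (p n n) ⟩
  ι (suc n) * ι m * (0ℚ + s * (0ℚ + r * p n n))
    ≡⟨ cong₂ (λ a c → ι (suc n) * ι m * (a + s * (c + r * p n n)))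
         (p-degree n (ℕ.n<1+n n)) (q-degree n (ℕ.n<1+n n)) ⟨
  ι (suc n) * ι m * p (suc n) (suc n)
    ≡⟨ cong (λ z → ι (suc n) * ι m * z) eq ⟩
  ι (suc n) * ι m * 0ℚ
    ≡⟨ *-zeroʳ (ι (suc n) * ι m) ⟩
  2ℚ * 0ℚ ∎))
  where
  m : ℕ
  m = suc (double n)
  r s : ℚ
  r = + 2 / m
  s = + 1 / suc n
  regroup : ∀ a s m r x → a * s * (m * r) * x ≡ a * m * (0ℚ + s * (0ℚ + r * x))
  regroup = solve-∀ ℚ-ring

-- Evaluation of the two Hankel determinants

-- Replacing the last column by the combination with coefficients `c` multiplies the determinant by
-- the last coefficient; the new column is concentrated in row `r`, and the expansion runs along it.
det-eliminateLast : ∀ {n} (A : Matrix (suc n)) (c : Fin (suc n) → ℚ) r →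
  (∀ i → i ≢ r → sum (λ k → c k * A i k) ≡ 0ℚ) →
  c (fromℕ n) * det A
    ≡ (- 1ℚ) ^ (toℕ r ℕ.+ n) * sum (λ k → c k * A r k) * det (λ i j → A (punchIn r i) (inject₁ j))
det-eliminateLast {n} A c r z≡0 = begin
  c last * det A
    ≡⟨ det-combineColumns A last c ⟨
  det (A [ last ≔ z ])
    ≡⟨ det-lastColumn (A [ last ≔ z ]) r (λ i i≢r → trans (column-updated A last z i) (z≡0 i i≢r)) ⟩
  (- 1ℚ) ^ (toℕ r ℕ.+ n) * (A [ last ≔ z ]) r last * det (λ i j → (A [ last ≔ z ]) (punchIn r i) (inject₁ j))
    ≡⟨ cong₂ (λ a d → (- 1ℚ) ^ (toℕ r ℕ.+ n) * a * d) (column-updated A last z r)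
         (det-cong λ i j → column-other A last z (punchIn r i) (inject₁ j) (Fin.fromℕ≢inject₁ ∘ sym)) ⟩
  (- 1ℚ) ^ (toℕ r ℕ.+ n) * z r * det (λ i j → A (punchIn r i) (inject₁ j)) ∎
  where
  last : Fin (suc n)
  last = fromℕ n
  z : Fin (suc n) → ℚ
  z i = sum (λ k → c k * A i k)

module _ (n : ℕ) where

  -- The common complementary minor; for n ≥ 1 it is the Hankel determinant of E₂ₖ₊₁(1) of size n.
  Δ : ℚ
  Δ = det {n} (λ i j → b (suc (toℕ i ℕ.+ toℕ j)))

  pₙ : Fin (suc n) → ℚ
  pₙ k = p n (toℕ k)

  v-below : ∀ {i} → i ℕ.< n → v n (suc i) ≡ 0ℚ
  v-below i<n = y-below (s≤s (double-mono-< i<n))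

  pₙ-last : pₙ (fromℕ n) ≡ p n n
  pₙ-last = cong (p n) (Fin.toℕ-fromℕ n)

  -- For 1 ≤ i ≤ n, row i of the combined column is the (2i-1)-st derivative at 0 of u²ⁿ⁺¹, which
  -- vanishes. Row 0 keeps the constant of integration `harmonic n`.
  hankel-b : p n n * H n b ≡ (- 1ℚ) ^ n * harmonic n * Δ
  hankel-b = begin
    p n n * H n b
      ≡⟨ cong (_* H n b) pₙ-last ⟨
    pₙ (fromℕ n) * det A
      ≡⟨ det-eliminateLast A pₙ Fin.zero below ⟩
    (- 1ℚ) ^ n * apply (suc n) (p n) b 0 * det (λ i j → A (Fin.suc i) (inject₁ j))
      ≡⟨ cong₂ (λ a d → (- 1ℚ) ^ n * a * d) (apply-p n (ℕ.n<1+n n) 0)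
           (det-cong {n} λ i j → cong (λ m → b (suc (toℕ i ℕ.+ m))) (Fin.toℕ-inject₁ j)) ⟩
    (- 1ℚ) ^ n * harmonic n * Δ ∎
    where
    A : Matrix (suc n)
    A i j = b (toℕ i ℕ.+ toℕ j)
    below : ∀ i → i ≢ Fin.zero → sum (λ k → pₙ k * A i k) ≡ 0ℚ
    below Fin.zero    0≢0 = contradiction refl 0≢0
    below (Fin.suc i) _   = trans (apply-p n (ℕ.n<1+n n) (suc (toℕ i))) (v-below (Fin.toℕ<n i))

  -- Now row i holds the (2i+1)-st derivative at 0 of u²ⁿ⁺¹, which vanishes for i < n, so only the
  -- bottom corner remains.
  hankel-E : p n n * H n (λ k → E (2 ℕ.* k ℕ.+ 1) 1ℚ) ≡ (- 1ℚ) ^ (n ℕ.+ n) * v n (suc n) * Δ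
  hankel-E = begin
    p n n * H n (λ k → E (2 ℕ.* k ℕ.+ 1) 1ℚ)
      ≡⟨ cong₂ _*_ (sym pₙ-last) (det-cong {suc n} λ i j → E-odd (toℕ i ℕ.+ toℕ j)) ⟩
    pₙ (fromℕ n) * det A
      ≡⟨ det-eliminateLast A pₙ (fromℕ n) above ⟩
    (- 1ℚ) ^ (toℕ (fromℕ n) ℕ.+ n) * apply (suc n) (p n) b (suc (toℕ (fromℕ n)))
      * det (λ i j → A (punchIn (fromℕ n) i) (inject₁ j))
      ≡⟨ cong₂ (λ m d → (- 1ℚ) ^ (m ℕ.+ n) * apply (suc n) (p n) b (suc m) * d) (Fin.toℕ-fromℕ n)
           (det-cong {n} λ i j → cong₂ (λ k l → b (suc (k ℕ.+ l)))
             (trans (cong toℕ (punchIn-fromℕ i)) (Fin.toℕ-inject₁ i)) (Fin.toℕ-inject₁ j)) ⟩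
    (- 1ℚ) ^ (n ℕ.+ n) * apply (suc n) (p n) b (suc n) * Δ
      ≡⟨ cong (λ a → (- 1ℚ) ^ (n ℕ.+ n) * a * Δ) (apply-p n (ℕ.n<1+n n) (suc n)) ⟩
    (- 1ℚ) ^ (n ℕ.+ n) * v n (suc n) * Δ ∎
    where
    A : Matrix (suc n)
    A i j = b (suc (toℕ i ℕ.+ toℕ j))
    above : ∀ i → i ≢ fromℕ n → sum (λ k → pₙ k * A i k) ≡ 0ℚ
    above i i≢n = trans (apply-p n (ℕ.n<1+n n) (suc (toℕ i)))
      (v-below (ℕ.≤∧≢⇒< (Fin.toℕ≤pred[n] i)
        λ eq → i≢n (Fin.toℕ-injective (trans eq (sym (Fin.toℕ-fromℕ n))))))

-- The constant factor and the conclusion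

-1^-even : ∀ n → (- 1ℚ) ^ (n ℕ.+ n) ≡ 1ℚ
-1^-even zero    = refl
-1^-even (suc n) = begin
  - 1ℚ * (- 1ℚ) ^ (n ℕ.+ suc n)       ≡⟨ cong (λ m → - 1ℚ * (- 1ℚ) ^ m) (ℕ.+-suc n n) ⟩
  - 1ℚ * (- 1ℚ * (- 1ℚ) ^ (n ℕ.+ n))  ≡⟨ cong (λ z → - 1ℚ * (- 1ℚ * z)) (-1^-even n) ⟩
  1ℚ                                  ∎

-- The reciprocal of the leading derivative `y m m`; at m = 2n + 1 it is the constant of the
-- theorem.
κ : ℕ → ℚ
κ m = _/_ (+ (2 ℕ.^ m)) (m !) {{m !≢0}}

κ-y : ∀ m → κ m * y m m ≡ 1ℚ
κ-y m = *-cancelˡ (ι≢0 (m !) {{m !≢0}}) (begin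
  ι (m !) * (κ m * y m m)  ≡⟨ *-assoc (ι (m !)) (κ m) (y m m) ⟨
  ι (m !) * κ m * y m m    ≡⟨ cong (_* y m m) (/-cancel (+ (2 ℕ.^ m)) (m !) {{m !≢0}}) ⟩
  ι (2 ℕ.^ m) * y m m      ≡⟨ y-diagonal m ⟩
  ι (m !)                  ≡⟨ *-identityʳ (ι (m !)) ⟨
  ι (m !) * 1ℚ             ∎)

proposition3p3 : ∀ (n : ℕ) → 1 ℕ.≤ n →
    H n b ≡
    (- 1ℚ) ^ n
    * (_/_ (+ (2 ℕ.^ (2 ℕ.* n ℕ.+ 1))) ((2 ℕ.* n ℕ.+ 1) !) {{(2 ℕ.* n ℕ.+ 1) !≢0}})
    * harmonic n
    * H n (λ k → E (2 ℕ.* k ℕ.+ 1) 1ℚ)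
-- Multiplied by the nonzero leading coefficient `p n n`, both sides become multiples of `Δ n`, and
-- `κ m` cancels the corner entry `y m m`.
proposition3p3 n _ = *-cancelˡ (p-leading n) (sym (begin
  p n n * (σ * κ (2 ℕ.* n ℕ.+ 1) * h * c)   ≡⟨ cong (λ m → p n n * (σ * κ m * h * c)) odd ⟩
  p n n * (σ * κ m * h * c)                  ≡⟨ pull (p n n) σ (κ m) h c ⟩
  σ * κ m * h * (p n n * c)                  ≡⟨ cong (σ * κ m * h *_) (hankel-E n) ⟩
  σ * κ m * h * ((- 1ℚ) ^ (n ℕ.+ n) * y m m * Δ n)
    ≡⟨ cong (λ s → σ * κ m * h * (s * y m m * Δ n)) (-1^-even n) ⟩
  σ * κ m * h * (1ℚ * y m m * Δ n)           ≡⟨ regroup σ (κ m) h (y m m) (Δ n) ⟩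
  κ m * y m m * (σ * h * Δ n)                ≡⟨ cong (_* (σ * h * Δ n)) (κ-y m) ⟩
  1ℚ * (σ * h * Δ n)                         ≡⟨ *-identityˡ (σ * h * Δ n) ⟩
  σ * h * Δ n                                ≡⟨ hankel-b n ⟨
  p n n * H n b                              ∎))
  where
  m : ℕ
  m = suc (double n)
  σ h c : ℚ
  σ = (- 1ℚ) ^ n
  h = harmonic n
  c = H n (λ k → E (2 ℕ.* k ℕ.+ 1) 1ℚ)
  odd : 2 ℕ.* n ℕ.+ 1 ≡ m
  odd = trans (ℕ.+-comm (2 ℕ.* n) 1) (cong suc (sym (double≡2* n)))
  pull : ∀ a σ k h c → a * (σ * k * h * c) ≡ σ * k * h * (a * c)
  pull = solve-∀ ℚ-ring
  regroup : ∀ σ k h y d → σ * k * h * (1ℚ * y * d) ≡ k * y * (σ * h * d)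
  regroup = solve-∀ ℚ-ring
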